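{- Let $\mathcal{A}$ be any algorithm computing, without recomputation, an $n$-input FFT DAG on a BSP with $p$ processors, where $1<p\le n$. If each processor computes at most $\epsilon\, n\log n$ nodes of the FFT DAG, for an arbitrary constant $\epsilon\in(0,1)$, and the inputs are not initially replicated, then the communication complexity of $\mathcal{A}$ is \[H_{\mathcal{A}}(n,p)=\Omega\!\left(\frac{n\log n}{p\log(n/p)}\right).\]
   Context: BSP model: $p$ processors, each with an unbounded private local memory, connected by a communication network; computation proceeds in supersteps, each consisting of local computation and message sending (one data word per message) followed by a global synchronization. If $h_i$ is the maximum number of messages sent or received by any processor in superstep $i$, the communication complexity is $H=\sum_i h_i$. The $n$-input FFT DAG ($n$ a power of $2$) has vertices $\langle w,l\rangle$ with $0\le w<n$, $0\le l\le\log_2 n$, and an arc from $\langle w,l\rangle$ to $\langle w',l'\rangle$ iff $l'=l+1$ and either $w=w'$ or the binary representations of $w,w'$ differ exactly in the $l'$-th bit; level-$0$ vertices are inputs and level-$\log_2 n$ vertices are outputs. A vertex can be computed by a processor only once the values of its predecessors are available to it. "Without recomputation" means each vertex is computed exactly once; "inputs not initially replicated" means each input resides initially in the local memory of exactly one processor. No other I/O protocol is assumed. Within asymptotic notation, $\log x$ denotes $\max\{1,\log_2 x\}$; the constant in $\Omega$ may depend on $\epsilon$. -}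

module Defs where

open import Data.Nat using (ℕ; zero; suc; _+_; _*_; _^_; _≤_; _<_; _⊔_; _/_; _%_)
open import Data.Nat.Logarithm using (⌊log₂_⌋)
open import Data.Fin using (Fin; toℕ; _≟_)
open import Data.List using (List; length; filter; map; foldr; allFin; concatMap)
open import Data.Nat.ListAction using (sum)
open import Data.List.Membership.Propositional using (_∈_)
open import Data.Product using (Σ; _×_; _,_; proj₁; proj₂)
open import Data.Sum using (_⊎_)
open import Relation.Binary.PropositionalEquality using (_≡_; _≢_)
open import Relation.Nullary using (¬_; ¬?)

lg : ℕ → ℕ
lg x = 1 ⊔ ⌊log₂ x ⌋

-- floor division, with the (never used) convention n / 0 = 0
divℕ : ℕ → ℕ → ℕ
divℕ n zero = 0
divℕ n (suc q) = n / suc q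

bit : ℕ → ℕ → ℕ
bit zero w = w % 2
bit (suc j) w = bit j (w / 2)

DiffExactlyIn : ℕ → ℕ → ℕ → Set
DiffExactlyIn j w w' = (bit j w ≢ bit j w') × (∀ i → i ≢ j → bit i w ≡ bit i w')

-- The n-input FFT DAG with n = 2 ^ k: vertices ⟨w , l⟩, 0 ≤ w < n, 0 ≤ l ≤ k

Vertex : ℕ → Set
Vertex k = Fin (2 ^ k) × Fin (suc k)

wire : ∀ {k} → Vertex k → ℕ
wire v = toℕ (proj₁ v)

level : ∀ {k} → Vertex k → ℕ
level v = toℕ (proj₂ v)

IsInput : ∀ {k} → Vertex k → Set
IsInput v = level v ≡ 0

-- arc ⟨w,l⟩ → ⟨w',l'⟩ iff l' = l+1 and (w = w' or w,w' differ exactly in the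
-- l'-th bit, bits counted 1,2,… from the least significant one, i.e. bit l
-- in 0-indexed numbering)
Arc : ∀ {k} → Vertex k → Vertex k → Set
Arc u v = (level v ≡ suc (level u)) × (wire u ≡ wire v ⊎ DiffExactlyIn (level u) (wire u) (wire v))

allVertices : (k : ℕ) → List (Vertex k)
allVertices k = concatMap (λ w → map (λ l → (w , l)) (allFin (suc k))) (allFin (2 ^ k))

record BSPAlg (k p : ℕ) : Set where
  field
    T     : ℕ
    place : Fin (2 ^ k) → Fin p                 -- input ⟨w,0⟩ initially held (only) by place w
    proc  : Vertex k → Fin p                    -- processor computing a non-input vertex
    step  : Vertex k → Fin T
    rank  : Vertex k → ℕ                        -- order of computation inside a superstep
    msgs  : Fin T → List (Fin p × Fin p × Vertex k)
      -- messages (sender , receiver , vertex whose value is sent) of each superstep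

module _ {k p : ℕ} (A : BSPAlg k p) where
  open BSPAlg A

  Received : Fin p → Vertex k → Fin T → Set
  Received P u t = Σ (Fin T) λ t' → (toℕ t' < toℕ t) × Σ (Fin p) λ Q → (Q , P , u) ∈ msgs t'

  -- P holds the value of u at the communication phase of superstep t
  Has : Fin p → Vertex k → Fin T → Set
  Has P u t = (IsInput u × place (proj₁ u) ≡ P)
            ⊎ (¬ IsInput u × proc u ≡ P × toℕ (step u) ≤ toℕ t)
            ⊎ Received P u t

  Avail : Fin p → Vertex k → Fin T → ℕ → Set
  Avail P u t r = (IsInput u × place (proj₁ u) ≡ P)
                ⊎ (¬ IsInput u × proc u ≡ P
                     × (toℕ (step u) < toℕ t ⊎ (step u ≡ t × rank u < r)))
                ⊎ Received P u t

  record Valid : Set where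
    field
      compute-ok : ∀ v → ¬ IsInput v → ∀ u → Arc u v → Avail (proc v) u (step v) (rank v)
      send-ok    : ∀ t Q R u → (Q , R , u) ∈ msgs t → Has Q u t

  computedBy : Fin p → ℕ
  computedBy P = length (filter (λ v → proc v ≟ P) (filter (λ v → ¬? (proj₂ v ≟ Data.Fin.zero)) (allVertices k)))

  sent : Fin T → Fin p → ℕ
  sent t P = length (filter (λ m → proj₁ m ≟ P) (msgs t))

  received : Fin T → Fin p → ℕ
  received t P = length (filter (λ m → proj₁ (proj₂ m) ≟ P) (msgs t))

  h : Fin T → ℕ
  h t = foldr _⊔_ 0 (map (λ P → sent t P ⊔ received t P) (allFin p))

  H : ℕ
  H = sum (map h (allFin T))

module Submission where

open import Defs
open import Data.Bool using (Bool; true; false)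
open import Data.Empty using (⊥)
open import Data.Fin using (Fin; zero; suc; toℕ; inject₁; fromℕ; fromℕ<)
import Data.Fin as Fin
open import Data.Fin.Properties using (toℕ<n; toℕ-fromℕ; toℕ-fromℕ<; toℕ-inject₁; toℕ-injective)
open import Data.List using (List; []; _∷_; _++_; map; filter; foldr; length; allFin; concatMap; tabulate)
open import Data.List.Membership.Propositional using (_∈_)
open import Data.List.Membership.Propositional.Properties using (∈-allFin; ∈-concatMap⁺)
open import Data.List.Properties using (map-++; map-tabulate)
import Data.List.Relation.Unary.Any as Any
open Any using (here; there)
open import Data.Nat using (ℕ; zero; suc; _+_; _*_; _∸_; _^_; _≤_; _<_; _⊔_; _/_; _%_; ⌊_/2⌋; ⌈_/2⌉; z≤n; s≤s; >-nonZero; _≟_; _≤?_; _<?_)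
open import Data.Nat.DivMod
open import Data.Nat.Divisibility using (n∣m*n)
open import Data.Nat.ListAction using (sum)
open import Data.Nat.ListAction.Properties using (sum-++)
open import Data.Nat.Logarithm
open import Data.Nat.Properties hiding (_≟_; _≤?_; _<?_)
open import Data.Nat.Tactic.RingSolver using (solve-∀)
open import Data.Product using (Σ; _×_; _,_; proj₁; proj₂)
open import Data.Product.Properties using (≡-dec)
open import Data.Sum using (_⊎_; inj₁; inj₂; [_,_]′)
open import Function using (_∘_; id)
open import Relation.Binary.PropositionalEquality
open import Relation.Nullary using (Dec; yes; no; ¬_; ¬?; contradiction)

-- Each input emits one unit of mass (2 ^ k, to stay in ℕ), which every vertex splits evenly
-- between its two outgoing arcs, so that it ends up uniformly spread over the outputs.  Let G P y
-- be the mass of input y held by processor P and Φ = Σ_P Σ_y φ (G P y) with φ x ≈ x log₂ x.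
-- Local computation leaves G unchanged.  Initially Φ is n² log n; at the end it is at most
-- n² log N if no processor computes more than N outputs.  In between, the loss of an arc leaving P
-- is at most about n log (number of arcs held by P), which a linear bound on log₂ turns into an
-- average over all processors, so that Φ drops by O(h n p log (n/p)) in a superstep of degree h.
--
-- That N = O(H) is an isoperimetric property.  By straight paths a processor with a fraction of
-- at most ε of the work has at most a fraction ε of the inputs, up to O(H); each of its outputs
-- needs mass from all the other inputs, and every received value brings in at most n units in all.
-- The same property gives n = O(p H), which suffices if log (n/p) is of order log n; if instead
-- p is close to n and N exceeds √n, then H is large enough already.

-- Indicators and finite sums

private variable
  α β : Set

⟦_⟧ : Dec α → ℕ
⟦ yes _ ⟧ = 1
⟦ no _ ⟧ = 0

⟦⟧-yes : (d : Dec α) → α → ⟦ d ⟧ ≡ 1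
⟦⟧-yes (yes _) x = refl
⟦⟧-yes (no ¬x) x = contradiction x ¬x

⟦⟧-no : (d : Dec α) → ¬ α → ⟦ d ⟧ ≡ 0
⟦⟧-no (yes x) ¬x = contradiction x ¬x
⟦⟧-no (no _) ¬x = refl

⟦⟧≤1 : (d : Dec α) → ⟦ d ⟧ ≤ 1
⟦⟧≤1 (yes _) = ≤-refl
⟦⟧≤1 (no _) = z≤n

⟦⟧-mono : (d : Dec α) (d' : Dec β) → (α → β) → ⟦ d ⟧ ≤ ⟦ d' ⟧
⟦⟧-mono (yes x) d' f = ≤-reflexive (sym (⟦⟧-yes d' (f x)))
⟦⟧-mono (no _) d' f = z≤n

⟦⟧-cong : (d : Dec α) (d' : Dec β) → (α → β) → (β → α) → ⟦ d ⟧ ≡ ⟦ d' ⟧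
⟦⟧-cong d d' f g = ≤-antisym (⟦⟧-mono d d' f) (⟦⟧-mono d' d g)

⟦⟧-⊎ : {Z : Set} (d : Dec α) (d' : Dec β) (d'' : Dec Z) →
       (α → β ⊎ Z) → (β → α) → (Z → α) → (β → Z → ⊥) → ⟦ d ⟧ ≡ ⟦ d' ⟧ + ⟦ d'' ⟧
⟦⟧-⊎ (no ¬x) d' d'' f g h k rewrite ⟦⟧-no d' (¬x ∘ g) | ⟦⟧-no d'' (¬x ∘ h) = refl
⟦⟧-⊎ (yes x) d' d'' f g h k with f x
... | inj₁ y rewrite ⟦⟧-yes d' y | ⟦⟧-no d'' (k y) = refl
... | inj₂ z rewrite ⟦⟧-yes d'' z | ⟦⟧-no d' (λ y → k y z) = refl

opaque
  ∑ : List α → (α → ℕ) → ℕ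
  ∑ xs f = sum (map f xs)

infix 6.5 ∑
syntax ∑ xs (λ x → e) = ∑[ x ∈ xs ] e

opaque
  unfolding ∑

  ∑-def : (xs : List α) (f : α → ℕ) → ∑ xs f ≡ sum (map f xs)
  ∑-def xs f = refl

  ∑-[] : (f : α → ℕ) → ∑ [] f ≡ 0
  ∑-[] f = refl

  ∑-∷ : (x : α) (xs : List α) (f : α → ℕ) → ∑ (x ∷ xs) f ≡ f x + ∑ xs f
  ∑-∷ x xs f = refl

  ∑-cong : {xs : List α} {f g : α → ℕ} → (∀ x → f x ≡ g x) → ∑ xs f ≡ ∑ xs g
  ∑-cong {xs = []} eq = refl
  ∑-cong {xs = x ∷ xs} eq = cong₂ _+_ (eq x) (∑-cong {xs = xs} eq)

  ∑-mono : {xs : List α} {f g : α → ℕ} → (∀ x → f x ≤ g x) → ∑ xs f ≤ ∑ xs g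
  ∑-mono {xs = []} le = z≤n
  ∑-mono {xs = x ∷ xs} le = +-mono-≤ (le x) (∑-mono {xs = xs} le)

  ∑-0 : {xs : List α} {f : α → ℕ} → (∀ x → f x ≡ 0) → ∑ xs f ≡ 0
  ∑-0 {xs = []} eq = refl
  ∑-0 {xs = x ∷ xs} eq = cong₂ _+_ (eq x) (∑-0 {xs = xs} eq)

  ∑-+ : {xs : List α} {f g : α → ℕ} → ∑[ x ∈ xs ] (f x + g x) ≡ ∑ xs f + ∑ xs g
  ∑-+ {xs = []} = refl
  ∑-+ {xs = x ∷ xs} {f} {g} = trans (cong (f x + g x +_) (∑-+ {xs = xs} {f} {g}))
    (interchange (f x) (g x) _ _)
    where
      interchange : ∀ a b c d → a + b + (c + d) ≡ a + c + (b + d)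
      interchange = solve-∀

  ∑-*ˡ : {xs : List α} (c : ℕ) {f : α → ℕ} → ∑[ x ∈ xs ] (c * f x) ≡ c * ∑ xs f
  ∑-*ˡ {xs = []} c = sym (*-zeroʳ c)
  ∑-*ˡ {xs = x ∷ xs} c {f} =
    trans (cong (c * f x +_) (∑-*ˡ {xs = xs} c {f})) (sym (*-distribˡ-+ c (f x) _))

  ∑-*ʳ : {xs : List α} (c : ℕ) {f : α → ℕ} → ∑[ x ∈ xs ] (f x * c) ≡ ∑ xs f * c
  ∑-*ʳ {xs = []} c = refl
  ∑-*ʳ {xs = x ∷ xs} c {f} =
    trans (cong (f x * c +_) (∑-*ʳ {xs = xs} c {f})) (sym (*-distribʳ-+ c (f x) _))

  ∑-swap : {xs : List α} {ys : List β} {f : α → β → ℕ} →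
           ∑[ x ∈ xs ] ∑[ y ∈ ys ] f x y ≡ ∑[ y ∈ ys ] ∑[ x ∈ xs ] f x y
  ∑-swap {xs = []} {ys} = sym (∑-0 {xs = ys} λ _ → refl)
  ∑-swap {xs = x ∷ xs} {ys} {f} =
    trans (cong (∑ ys (f x) +_) (∑-swap {xs = xs} {ys} {f})) (sym (∑-+ {xs = ys}))

  ∑-++ : (xs ys : List α) {f : α → ℕ} → ∑ (xs ++ ys) f ≡ ∑ xs f + ∑ ys f
  ∑-++ xs ys {f} = trans (cong sum (map-++ f xs ys)) (sum-++ (map f xs) (map f ys))

  ∑-concatMap : (xs : List α) (g : α → List β) {f : β → ℕ} →
                ∑ (concatMap g xs) f ≡ ∑[ x ∈ xs ] ∑ (g x) f
  ∑-concatMap [] g = refl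
  ∑-concatMap (x ∷ xs) g {f} =
    trans (∑-++ (g x) (concatMap g xs)) (cong (∑ (g x) f +_) (∑-concatMap xs g))

  ∑-map : (g : α → β) (xs : List α) {f : β → ℕ} → ∑ (map g xs) f ≡ ∑ xs (f ∘ g)
  ∑-map g [] = refl
  ∑-map g (x ∷ xs) {f} = cong (f (g x) +_) (∑-map g xs)

  ∑-∈ : {xs : List α} {x : α} (f : α → ℕ) → x ∈ xs → f x ≤ ∑ xs f
  ∑-∈ f (here refl) = m≤m+n _ _
  ∑-∈ {xs = y ∷ _} f (there x∈) = ≤-trans (∑-∈ f x∈) (m≤n+m _ (f y))

  ∑-tabulate : ∀ {n} (g : Fin n → α) (f : α → ℕ) → ∑ (tabulate g) f ≡ ∑ (allFin n) (f ∘ g)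
  ∑-tabulate g f = cong sum (trans (map-tabulate g f) (sym (map-tabulate id (f ∘ g))))

∑-allFin-0 : (f : Fin 0 → ℕ) → ∑ (allFin 0) f ≡ 0
∑-allFin-0 = ∑-[]

∑-allFin-suc : ∀ {n} (f : Fin (suc n) → ℕ) → ∑ (allFin (suc n)) f ≡ f zero + ∑ (allFin n) (f ∘ suc)
∑-allFin-suc f = trans (∑-∷ _ _ f) (cong (f zero +_) (∑-tabulate suc f))

∑-allFin-last : ∀ {n} (f : Fin (suc n) → ℕ) →
                ∑ (allFin (suc n)) f ≡ ∑ (allFin n) (f ∘ inject₁) + f (fromℕ n)
∑-allFin-last {zero} f = begin
  ∑ (allFin 1) f                              ≡⟨ ∑-allFin-suc f ⟩
  f zero + ∑ (allFin 0) (f ∘ suc)             ≡⟨ cong (f zero +_) (∑-allFin-0 _) ⟩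
  f zero + 0                                  ≡⟨ +-comm (f zero) 0 ⟩
  0 + f zero                                  ≡⟨ cong (_+ f zero) (∑-allFin-0 _) ⟨
  ∑ (allFin 0) (f ∘ inject₁) + f zero         ∎
  where open ≡-Reasoning
∑-allFin-last {suc n} f = begin
  ∑ (allFin (2 + n)) f                                            ≡⟨ ∑-allFin-suc f ⟩
  f zero + ∑ (allFin (suc n)) (f ∘ suc)                           ≡⟨ cong (f zero +_) (∑-allFin-last (f ∘ suc)) ⟩
  f zero + (∑ (allFin n) (f ∘ suc ∘ inject₁) + f (fromℕ (suc n))) ≡⟨ +-assoc (f zero) _ _ ⟨
  f zero + ∑ (allFin n) (f ∘ inject₁ ∘ suc) + f (fromℕ (suc n))   ≡⟨ cong (_+ f (fromℕ (suc n))) (∑-allFin-suc (f ∘ inject₁)) ⟨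
  ∑ (allFin (suc n)) (f ∘ inject₁) + f (fromℕ (suc n))            ∎
  where open ≡-Reasoning

-- Both sides are the sum over `Fin (suc n)`, split at the first and at the last index. It later
-- matches the levels where arcs end with the levels where arcs start.
∑-telescope : ∀ {n} (f : Fin (suc n) → ℕ) →
              f zero + ∑ (allFin n) (f ∘ suc) ≡ ∑ (allFin n) (f ∘ inject₁) + f (fromℕ n)
∑-telescope f = trans (sym (∑-allFin-suc f)) (∑-allFin-last f)

∑-const : ∀ n (c : ℕ) → ∑[ _ ∈ allFin n ] c ≡ n * c
∑-const zero c = ∑-allFin-0 _
∑-const (suc n) c = trans (∑-allFin-suc _) (cong (c +_) (∑-const n c))

∑-δ : ∀ {n} (i : Fin n) (f : Fin n → ℕ) → ∑[ j ∈ allFin n ] (⟦ i Fin.≟ j ⟧ * f j) ≡ f i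
∑-δ {suc n} i f = trans (∑-allFin-suc _) (lemma i)
  where
    lemma : ∀ i → ⟦ i Fin.≟ zero ⟧ * f zero + ∑[ j ∈ allFin n ] (⟦ i Fin.≟ suc j ⟧ * f (suc j)) ≡ f i
    lemma zero = trans (cong₂ _+_ (+-identityʳ (f zero)) (∑-0 λ _ → refl)) (+-identityʳ (f zero))
    lemma (suc i) = trans (∑-cong λ j → cong (_* f (suc j))
        (⟦⟧-cong (suc i Fin.≟ suc j) (i Fin.≟ j) (λ { refl → refl }) (λ { refl → refl })))
      (∑-δ i (f ∘ suc))

-- Expand `f (π i)` as a sum over j weighted by the indicator of `π i ≡ j`. After the sums are
-- exchanged, this condition may be replaced by `π j ≡ i`, and the inner sum collapses.
∑-involution : ∀ {n} (π : Fin n → Fin n) → (∀ i → π (π i) ≡ i) → (f : Fin n → ℕ) →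
               ∑ (allFin n) (f ∘ π) ≡ ∑ (allFin n) f
∑-involution {n} π ππ f = begin
  ∑[ i ∈ allFin n ] f (π i)                                     ≡⟨ (∑-cong λ i → ∑-δ (π i) f) ⟨
  ∑[ i ∈ allFin n ] ∑[ j ∈ allFin n ] (⟦ π i Fin.≟ j ⟧ * f j)   ≡⟨ ∑-swap ⟩
  ∑[ j ∈ allFin n ] ∑[ i ∈ allFin n ] (⟦ π i Fin.≟ j ⟧ * f j)   ≡⟨ (∑-cong λ j → ∑-cong λ i → cong (_* f j)
      (⟦⟧-cong (π i Fin.≟ j) (π j Fin.≟ i)
        (λ { refl → ππ i }) (λ { refl → ππ j }))) ⟩
  ∑[ j ∈ allFin n ] ∑[ i ∈ allFin n ] (⟦ π j Fin.≟ i ⟧ * f j)   ≡⟨ (∑-cong λ j → ∑-δ (π j) (λ _ → f j)) ⟩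
  ∑ (allFin n) f                                                ∎
  where open ≡-Reasoning

∑-filter : {P : α → Set} (P? : ∀ x → Dec (P x)) (xs : List α) {f : α → ℕ} →
           ∑ (filter P? xs) f ≡ ∑[ x ∈ xs ] (⟦ P? x ⟧ * f x)
∑-filter P? [] = trans (∑-[] _) (sym (∑-[] _))
∑-filter P? (x ∷ xs) {f} with P? x in eq
... | yes _ = trans (∑-∷ _ _ f) (trans (cong₂ _+_ (sym (+-identityʳ (f x))) (∑-filter P? xs))
  (trans (cong (λ d → ⟦ d ⟧ * f x + (∑[ x ∈ xs ] ⟦ P? x ⟧ * f x)) (sym eq)) (sym (∑-∷ _ _ _))))
... | no _ = trans (∑-filter P? xs) (trans (cong (λ d → ⟦ d ⟧ * f x + (∑[ x ∈ xs ] ⟦ P? x ⟧ * f x)) (sym eq)) (sym (∑-∷ _ _ _)))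

length-∑ : (xs : List α) → length xs ≡ ∑[ _ ∈ xs ] 1
length-∑ [] = sym (∑-[] _)
length-∑ (x ∷ xs) = trans (cong suc (length-∑ xs)) (sym (∑-∷ x xs _))

length-filter-∑ : {P : α → Set} (P? : ∀ x → Dec (P x)) (xs : List α) →
                  length (filter P? xs) ≡ ∑[ x ∈ xs ] ⟦ P? x ⟧
length-filter-∑ P? xs = trans (length-∑ (filter P? xs))
  (trans (∑-filter P? xs) (∑-cong λ x → *-identityʳ ⟦ P? x ⟧))

-- Logarithms and the function x log₂ x

n≤2^n : ∀ n → n ≤ 2 ^ n
n≤2^n zero = z≤n
n≤2^n (suc n) = ≤-trans (+-mono-≤ (m^n>0 2 n) (n≤2^n n)) (≤-reflexive (sym (cong (2 ^ n +_) (+-identityʳ (2 ^ n)))))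

⌊log₂n⌋≤n : ∀ n → ⌊log₂ n ⌋ ≤ n
⌊log₂n⌋≤n n = ≤-trans (⌊log₂⌋-mono-≤ (n≤2^n n)) (≤-reflexive (⌊log₂[2^n]⌋≡n n))

n<2^[1+⌊log₂n⌋] : ∀ n → n < 2 ^ suc ⌊log₂ n ⌋
n<2^[1+⌊log₂n⌋] n = ≰⇒> λ le → <-irrefl refl
  (≤-trans (≤-reflexive (sym (⌊log₂[2^n]⌋≡n (suc ⌊log₂ n ⌋)))) (⌊log₂⌋-mono-≤ le))

-- Linear bounds replace the concavity of log₂.
⌊log₂⌋-tangent : ∀ i n → 2 ^ i * ⌊log₂ n ⌋ ≤ 2 ^ i * i + n
⌊log₂⌋-tangent zero n = ≤-trans (≤-reflexive (+-identityʳ _)) (⌊log₂n⌋≤n n)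
⌊log₂⌋-tangent (suc i) n = begin
  2 ^ suc i * ⌊log₂ n ⌋                                  ≤⟨ *-monoʳ-≤ (2 ^ suc i) (m≤n+m∸n ⌊log₂ n ⌋ 1) ⟩
  2 ^ suc i * (1 + (⌊log₂ n ⌋ ∸ 1))                      ≡⟨ cong (λ x → 2 ^ suc i * (1 + x)) (⌊log₂⌊n/2⌋⌋≡⌊log₂n⌋∸1 n) ⟨
  2 ^ suc i * (1 + ⌊log₂ ⌊ n /2⌋ ⌋)                      ≡⟨ regroup (2 ^ i) _ ⟩
  2 ^ suc i + 2 * (2 ^ i * ⌊log₂ ⌊ n /2⌋ ⌋)              ≤⟨ +-monoʳ-≤ (2 ^ suc i) (*-monoʳ-≤ 2 (⌊log₂⌋-tangent i ⌊ n /2⌋)) ⟩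
  2 ^ suc i + 2 * (2 ^ i * i + ⌊ n /2⌋)                  ≡⟨ regroup' (2 ^ i) i ⌊ n /2⌋ ⟩
  2 ^ suc i * suc i + (⌊ n /2⌋ + ⌊ n /2⌋)                ≤⟨ +-monoʳ-≤ (2 ^ suc i * suc i) (+-monoʳ-≤ ⌊ n /2⌋ (⌊n/2⌋≤⌈n/2⌉ n)) ⟩
  2 ^ suc i * suc i + (⌊ n /2⌋ + ⌊ suc n /2⌋)            ≡⟨ cong (2 ^ suc i * suc i +_) (⌊n/2⌋+⌈n/2⌉≡n n) ⟩
  2 ^ suc i * suc i + n                                  ∎
  where
    open ≤-Reasoning
    regroup : ∀ a b → 2 * a * (1 + b) ≡ 2 * a + 2 * (a * b)
    regroup = solve-∀
    regroup' : ∀ a i c → 2 * a + 2 * (a * i + c) ≡ 2 * a * suc i + (c + c)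
    regroup' = solve-∀

-- A discrete version of x log₂ x.
φ : ℕ → ℕ
φ zero = 0
φ (suc n) = φ n + ⌊log₂ suc n ⌋

-- Discrete convexity: the increments of `φ` are nondecreasing, so the b increments that follow
-- position a sum to at least as much as the first b.
φ-superadditive : ∀ a b → φ a + φ b ≤ φ (a + b)
φ-superadditive a zero = ≤-reflexive (trans (+-identityʳ (φ a)) (cong φ (sym (+-identityʳ a))))
φ-superadditive a (suc b) rewrite +-suc a b | sym (+-assoc (φ a) (φ b) ⌊log₂ suc b ⌋) =
  +-mono-≤ (φ-superadditive a b) (⌊log₂⌋-mono-≤ (s≤s (m≤n+m b a)))

φ-superadditive-∑ : (xs : List α) (f : α → ℕ) → ∑[ x ∈ xs ] φ (f x) ≤ φ (∑ xs f)
φ-superadditive-∑ [] f = ≤-trans (≤-reflexive (∑-[] _)) z≤n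
φ-superadditive-∑ (x ∷ xs) f = begin
  ∑[ y ∈ x ∷ xs ] φ (f y)          ≡⟨ ∑-∷ x xs _ ⟩
  φ (f x) + (∑[ y ∈ xs ] φ (f y))  ≤⟨ +-monoʳ-≤ (φ (f x)) (φ-superadditive-∑ xs f) ⟩
  φ (f x) + φ (∑ xs f)             ≤⟨ φ-superadditive (f x) _ ⟩
  φ (f x + ∑ xs f)                 ≡⟨ cong φ (∑-∷ x xs f) ⟨
  φ (∑ (x ∷ xs) f)                 ∎
  where open ≤-Reasoning

-- Each of the d increments beyond a is at most the last one; `φ-lower` compares them with the slope
-- at a instead.
φ-upper : ∀ a d → φ (a + d) ≤ φ a + d * ⌊log₂ (a + d) ⌋
φ-upper a zero = ≤-reflexive (trans (cong φ (+-identityʳ a)) (sym (+-identityʳ (φ a))))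
φ-upper a (suc d) rewrite +-suc a d = begin
  φ (a + d) + ⌊log₂ suc (a + d) ⌋                          ≤⟨ +-monoˡ-≤ _ (φ-upper a d) ⟩
  φ a + d * ⌊log₂ (a + d) ⌋ + ⌊log₂ suc (a + d) ⌋          ≤⟨ +-monoˡ-≤ _ (+-monoʳ-≤ (φ a) (*-monoʳ-≤ d (⌊log₂⌋-mono-≤ (n≤1+n (a + d))))) ⟩
  φ a + d * ⌊log₂ suc (a + d) ⌋ + ⌊log₂ suc (a + d) ⌋      ≡⟨ regroup (φ a) (d * ⌊log₂ suc (a + d) ⌋) _ ⟩
  φ a + (⌊log₂ suc (a + d) ⌋ + d * ⌊log₂ suc (a + d) ⌋)    ∎
  where
    open ≤-Reasoning
    regroup : ∀ a b c → a + b + c ≡ a + (c + b)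
    regroup = solve-∀

φ-lower : ∀ a d → φ a + d * ⌊log₂ a ⌋ ≤ φ (a + d)
φ-lower a zero = ≤-reflexive (trans (+-identityʳ (φ a)) (cong φ (sym (+-identityʳ a))))
φ-lower a (suc d) rewrite +-suc a d = begin
  φ a + (⌊log₂ a ⌋ + d * ⌊log₂ a ⌋)                ≡⟨ regroup (φ a) ⌊log₂ a ⌋ _ ⟩
  φ a + d * ⌊log₂ a ⌋ + ⌊log₂ a ⌋                  ≤⟨ +-mono-≤ (φ-lower a d) (⌊log₂⌋-mono-≤ (≤-trans (m≤m+n a d) (n≤1+n (a + d)))) ⟩
  φ (a + d) + ⌊log₂ suc (a + d) ⌋                  ∎
  where
    open ≤-Reasoning
    regroup : ∀ a b c → a + (b + c) ≡ a + c + b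
    regroup = solve-∀

-- By doubling: the 2 ^ j increments beyond 2 ^ j are each at least j. The deficit inherited from
-- the first half and the deficit of j against j + 1 are 2 * 2 ^ j each, together the deficit
-- allowed at j + 1.
φ-2^ : ∀ j → 2 ^ j * j ≤ φ (2 ^ j) + 2 * 2 ^ j
φ-2^ zero = z≤n
φ-2^ (suc j) = begin
  2 ^ suc j * suc j                                         ≡⟨ regroup (2 ^ j) j ⟩
  2 ^ j * j + (2 ^ j * j + 2 * 2 ^ j)                       ≤⟨ +-monoˡ-≤ _ (φ-2^ j) ⟩
  φ (2 ^ j) + 2 * 2 ^ j + (2 ^ j * j + 2 * 2 ^ j)           ≡⟨ regroup' (φ (2 ^ j)) (2 ^ j) j ⟩
  φ (2 ^ j) + 2 ^ j * j + 2 * 2 ^ suc j                     ≡⟨ cong (λ x → φ (2 ^ j) + 2 ^ j * x + 2 * 2 ^ suc j) (⌊log₂[2^n]⌋≡n j) ⟨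
  φ (2 ^ j) + 2 ^ j * ⌊log₂ 2 ^ j ⌋ + 2 * 2 ^ suc j         ≤⟨ +-monoˡ-≤ _ (φ-lower (2 ^ j) (2 ^ j)) ⟩
  φ (2 ^ j + 2 ^ j) + 2 * 2 ^ suc j                         ≡⟨ cong (λ x → φ (2 ^ j + x) + 2 * 2 ^ suc j) (+-identityʳ (2 ^ j)) ⟨
  φ (2 ^ suc j) + 2 * 2 ^ suc j                             ∎
  where
    open ≤-Reasoning
    regroup : ∀ a j → 2 * a * suc j ≡ a * j + (a * j + 2 * a)
    regroup = solve-∀
    regroup' : ∀ f a j → f + 2 * a + (a * j + 2 * a) ≡ f + a * j + 2 * (2 * a)
    regroup' = solve-∀

-- Wires and arcs of the FFT graph

[r+q*2]%2 : ∀ {r} q → r < 2 → (r + q * 2) % 2 ≡ r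
[r+q*2]%2 {r} q r<2 = trans ([m+kn]%n≡m%n r q 2) (m<n⇒m%n≡m r<2)

[r+q*2]/2 : ∀ {r} q → r < 2 → (r + q * 2) / 2 ≡ q
[r+q*2]/2 {r} q r<2 =
  trans (+-distrib-/-∣ʳ r (n∣m*n q {2})) (cong₂ _+_ (m<n⇒m/n≡0 r<2) (m*n/n≡m q 2))

2-split : ∀ w → w ≡ w % 2 + w / 2 * 2
2-split w = m≡m%n+[m/n]*n w 2

flipBit : ℕ → ℕ → ℕ
flipBit zero w = (1 ∸ w % 2) + w / 2 * 2
flipBit (suc j) w = w % 2 + flipBit j (w / 2) * 2

1∸r<2 : ∀ r → 1 ∸ r < 2
1∸r<2 r = s≤s (m∸n≤m 1 r)

flipBit-%2 : ∀ j w → flipBit (suc j) w % 2 ≡ w % 2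
flipBit-%2 j w = [r+q*2]%2 (flipBit j (w / 2)) (m%n<n w 2)

flipBit-/2 : ∀ j w → flipBit (suc j) w / 2 ≡ flipBit j (w / 2)
flipBit-/2 j w = [r+q*2]/2 (flipBit j (w / 2)) (m%n<n w 2)

flipBit₀-%2 : ∀ w → flipBit 0 w % 2 ≡ 1 ∸ w % 2
flipBit₀-%2 w = [r+q*2]%2 (w / 2) (1∸r<2 (w % 2))

flipBit₀-/2 : ∀ w → flipBit 0 w / 2 ≡ w / 2
flipBit₀-/2 w = [r+q*2]/2 (w / 2) (1∸r<2 (w % 2))

1∸r≢r : ∀ r → r ≢ 1 ∸ r
1∸r≢r zero ()
1∸r≢r (suc r) eq with trans eq (0∸n≡0 r)
... | ()

flipBit-involutive : ∀ j w → flipBit j (flipBit j w) ≡ w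
flipBit-involutive zero w = trans
  (cong₂ (λ r q → (1 ∸ r) + q * 2) (flipBit₀-%2 w) (flipBit₀-/2 w))
  (trans (cong (_+ w / 2 * 2) (m∸[m∸n]≡n (≤-pred (m%n<n w 2)))) (sym (2-split w)))
flipBit-involutive (suc j) w = trans
  (cong₂ (λ r q → r + q * 2) (flipBit-%2 j w)
    (trans (cong (flipBit j) (flipBit-/2 j w)) (flipBit-involutive j (w / 2))))
  (sym (2-split w))

bit-flipBit-≢ : ∀ j w → bit j w ≢ bit j (flipBit j w)
bit-flipBit-≢ zero w eq = 1∸r≢r (w % 2) (trans eq (flipBit₀-%2 w))
bit-flipBit-≢ (suc j) w eq = bit-flipBit-≢ j (w / 2) (trans eq (cong (bit j) (flipBit-/2 j w)))

bit-flipBit-≡ : ∀ j w i → i ≢ j → bit i w ≡ bit i (flipBit j w)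
bit-flipBit-≡ zero w zero i≢j = contradiction refl i≢j
bit-flipBit-≡ zero w (suc i) i≢j = cong (bit i) (sym (flipBit₀-/2 w))
bit-flipBit-≡ (suc j) w zero i≢j = sym (flipBit-%2 j w)
bit-flipBit-≡ (suc j) w (suc i) i≢j =
  trans (bit-flipBit-≡ j (w / 2) i (i≢j ∘ cong suc)) (cong (bit i) (sym (flipBit-/2 j w)))

r+q*2< : ∀ {r q m} → r < 2 → q < m → r + q * 2 < 2 * m
r+q*2< {r} {q} {m} r<2 q<m = ≤-trans (+-monoˡ-≤ (q * 2) r<2)
  (≤-trans (*-monoˡ-≤ 2 q<m) (≤-reflexive (*-comm m 2)))

/2< : ∀ {w} m → w < 2 * m → w / 2 < m
/2< {w} m w<2m = m<n*o⇒m/o<n (subst (w <_) (*-comm 2 m) w<2m)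

flipBit-< : ∀ j k w → j < k → w < 2 ^ k → flipBit j w < 2 ^ k
flipBit-< zero (suc k) w j<k w< = r+q*2< (1∸r<2 (w % 2)) (/2< (2 ^ k) w<)
flipBit-< (suc j) (suc k) w (s≤s j<k) w< =
  r+q*2< (m%n<n w 2) (flipBit-< j k (w / 2) j<k (/2< (2 ^ k) w<))

-- Encodes ancestry: `shift l y ≡ shift l w` means that input y reaches ⟨ w , l ⟩, since the arcs up
-- to level l can change only the l lowest bits.
shift : ℕ → ℕ → ℕ
shift zero w = w
shift (suc l) w = shift l (w / 2)

shift-< : ∀ k w → w < 2 ^ k → shift k w ≡ 0
shift-< zero w w<1 = n<1⇒n≡0 w<1
shift-< (suc k) w w< = shift-< k (w / 2) (/2< (2 ^ k) w<)

-- The inputs that reach ⟨ w , l + 1 ⟩ are the disjoint union of those that reach its two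
-- predecessors, whose wires are w and w with bit l flipped.
shift-split : ∀ l y w → ⟦ shift (suc l) y ≟ shift (suc l) w ⟧
                      ≡ ⟦ shift l y ≟ shift l w ⟧ + ⟦ shift l y ≟ shift l (flipBit l w) ⟧
shift-split zero y w = ⟦⟧-⊎ (y / 2 ≟ w / 2) (y ≟ w) (y ≟ flipBit 0 w)
    split (cong (_/ 2)) (λ { refl → flipBit₀-/2 w }) (λ { refl eq → bit-flipBit-≢ 0 w (cong (bit 0) eq) })
  where
    last-bit : ∀ r s → r < 2 → s < 2 → r ≡ s ⊎ r ≡ 1 ∸ s
    last-bit 0 0 _ _ = inj₁ refl
    last-bit 0 1 _ _ = inj₂ refl
    last-bit 1 0 _ _ = inj₂ refl
    last-bit 1 1 _ _ = inj₁ refl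
    last-bit (suc (suc _)) _ (s≤s (s≤s ())) _
    last-bit _ (suc (suc _)) _ (s≤s (s≤s ()))
    split : y / 2 ≡ w / 2 → y ≡ w ⊎ y ≡ flipBit 0 w
    split eq with last-bit (y % 2) (w % 2) (m%n<n y 2) (m%n<n w 2)
    ... | inj₁ r = inj₁ (trans (2-split y) (trans (cong₂ (λ r q → r + q * 2) r eq) (sym (2-split w))))
    ... | inj₂ r = inj₂ (trans (2-split y) (cong₂ (λ r q → r + q * 2) r eq))
shift-split (suc l) y w = trans (shift-split l (y / 2) (w / 2))
  (cong₂ _+_ refl (cong (λ v → ⟦ shift l (y / 2) ≟ shift l v ⟧) (sym (flipBit-/2 l w))))

flipFin : ∀ {k} → Fin k → Fin (2 ^ k) → Fin (2 ^ k)
flipFin {k} l w = fromℕ< (flipBit-< (toℕ l) k (toℕ w) (toℕ<n l) (toℕ<n w))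

toℕ-flipFin : ∀ {k} (l : Fin k) w → toℕ (flipFin l w) ≡ flipBit (toℕ l) (toℕ w)
toℕ-flipFin l w = toℕ-fromℕ< _

flipFin-involutive : ∀ {k} (l : Fin k) w → flipFin l (flipFin l w) ≡ w
flipFin-involutive l w = toℕ-injective (trans (toℕ-flipFin l (flipFin l w))
  (trans (cong (flipBit (toℕ l)) (toℕ-flipFin l w)) (flipBit-involutive (toℕ l) (toℕ w))))

-- (l , w , d) is the arc leaving ⟨ w , l ⟩ that keeps (d = false) or flips (d = true) a bit of w.
Edge : ℕ → Set
Edge k = Fin k × Fin (2 ^ k) × Bool

route : ∀ {k} → Bool → Fin k → Fin (2 ^ k) → Fin (2 ^ k)
route false l w = w
route true l w = flipFin l w

tail head : ∀ {k} → Edge k → Vertex k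
tail (l , w , d) = w , inject₁ l
head (l , w , d) = route d l w , suc l

edge-Arc : ∀ {k} (e : Edge k) → Arc (tail e) (head e)
edge-Arc (l , w , false) = cong suc (sym (toℕ-inject₁ l)) , inj₁ refl
edge-Arc (l , w , true) rewrite toℕ-inject₁ l | toℕ-flipFin l w =
  refl , inj₂ (bit-flipBit-≢ (toℕ l) (toℕ w) , bit-flipBit-≡ (toℕ l) (toℕ w))

-- The arcs as a list, and the mass they carry

edges : ∀ k → List (Edge k)
edges k = concatMap (λ l → concatMap (λ w → (l , w , false) ∷ (l , w , true) ∷ []) (allFin (2 ^ k))) (allFin k)

∑-edges : ∀ k (f : Edge k → ℕ) →
          ∑ (edges k) f ≡ ∑[ l ∈ allFin k ] ∑[ w ∈ allFin (2 ^ k) ] (f (l , w , false) + f (l , w , true))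
∑-edges k f = trans (∑-concatMap (allFin k) _) (∑-cong λ l →
  trans (∑-concatMap (allFin (2 ^ k)) _) (∑-cong λ w →
    trans (∑-∷ _ _ f) (cong (f (l , w , false) +_) (trans (∑-∷ _ _ f)
      (trans (cong (f (l , w , true) +_) (∑-[] f)) (+-identityʳ _))))))

-- The amount of the mass of input y that traverses e.
mass : ∀ {k} → Edge k → Fin (2 ^ k) → ℕ
mass {k} (l , w , d) y = 2 ^ (k ∸ suc (toℕ l)) * ⟦ shift (toℕ l) (toℕ y) ≟ shift (toℕ l) (toℕ w) ⟧

-- The mass 2 ^ k of y is shared equally by the 2 ^ l vertices of level l that y reaches.
vertexMass : ∀ {k} → Vertex k → Fin (2 ^ k) → ℕ
vertexMass {k} (w , l) y = 2 ^ (k ∸ toℕ l) * ⟦ shift (toℕ l) (toℕ y) ≟ shift (toℕ l) (toℕ w) ⟧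

2*2^[k∸1+l] : ∀ {k l} → l < k → 2 * 2 ^ (k ∸ suc l) ≡ 2 ^ (k ∸ l)
2*2^[k∸1+l] {k} {l} l<k = cong (2 ^_) (trans (sym (+-∸-assoc 1 l<k)) refl)

mass-out : ∀ {k} (l : Fin k) (w : Fin (2 ^ k)) d y →
           2 * mass (l , w , d) y ≡ vertexMass (w , inject₁ l) y
mass-out {k} l w d y rewrite toℕ-inject₁ l =
  trans (sym (*-assoc 2 (2 ^ (k ∸ suc (toℕ l))) _)) (cong₂ _*_ (2*2^[k∸1+l] (toℕ<n l)) refl)

-- The flipped arc into wire w starts on wire `flipFin l w`, so this is `shift-split` in terms of
-- mass.
mass-in : ∀ {k} (l : Fin k) (w : Fin (2 ^ k)) y →
          mass (l , w , false) y + mass (l , flipFin l w , true) y ≡ vertexMass (w , suc l) y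
mass-in {k} l w y rewrite toℕ-flipFin l w =
  trans (sym (*-distribˡ-+ (2 ^ (k ∸ suc (toℕ l))) _ _))
    (cong (2 ^ (k ∸ suc (toℕ l)) *_) (sym (shift-split (toℕ l) (toℕ y) (toℕ w))))

-- A tail at level l has 2 ^ l ancestors among the inputs, each of which puts 2 ^ (k ∸ suc l) on the
-- arc. So every arc carries n / 2 in all, whatever its level.
mass-total : ∀ {k} (e : Edge k) → 2 * (∑[ y ∈ allFin (2 ^ k) ] mass e y) ≡ 2 ^ k
mass-total {k} (l , w , d) = begin
  2 * (∑[ y ∈ allFin (2 ^ k) ] mass (l , w , d) y)                        ≡⟨ cong (2 *_) (∑-*ˡ (2 ^ (k ∸ suc (toℕ l)))) ⟩
  2 * (2 ^ (k ∸ suc (toℕ l)) * ancestors (toℕ l) w)                       ≡⟨ *-assoc 2 (2 ^ (k ∸ suc (toℕ l))) _ ⟨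
  2 * 2 ^ (k ∸ suc (toℕ l)) * ancestors (toℕ l) w                         ≡⟨ cong₂ _*_ (2*2^[k∸1+l] (toℕ<n l)) (count (toℕ l) w (<⇒≤ (toℕ<n l))) ⟩
  2 ^ (k ∸ toℕ l) * 2 ^ toℕ l                                             ≡⟨ ^-distribˡ-+-* 2 (k ∸ toℕ l) (toℕ l) ⟨
  2 ^ (k ∸ toℕ l + toℕ l)                                                 ≡⟨ cong (2 ^_) (m∸n+n≡m (<⇒≤ (toℕ<n l))) ⟩
  2 ^ k                                                                   ∎
  where
    open ≡-Reasoning
    ancestors : ℕ → Fin (2 ^ k) → ℕ
    ancestors j w = ∑[ y ∈ allFin (2 ^ k) ] ⟦ shift j (toℕ y) ≟ shift j (toℕ w) ⟧
    count : ∀ j w → j ≤ k → ancestors j w ≡ 2 ^ j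
    count zero w _ = trans
      (∑-cong λ y → trans (⟦⟧-cong (toℕ y ≟ toℕ w) (w Fin.≟ y) (sym ∘ toℕ-injective) (λ { refl → refl }))
                          (sym (*-identityʳ _)))
      (∑-δ w (λ _ → 1))
    count (suc j) w j<k = trans
      (∑-cong λ y → trans (shift-split j (toℕ y) (toℕ w))
        (cong₂ _+_ refl (cong (λ v → ⟦ shift j (toℕ y) ≟ shift j v ⟧)
              (sym (trans (toℕ-flipFin (fromℕ< j<k) w) (cong (λ i → flipBit i (toℕ w)) (toℕ-fromℕ< j<k)))))))
      (trans ∑-+ (trans (cong₂ _+_ (count j w (<⇒≤ j<k)) (count j (flipFin (fromℕ< j<k) w) (<⇒≤ j<k)))
        (cong (2 ^ j +_) (sym (+-identityʳ (2 ^ j))))))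

-- Let M l be the χ-weighted mass on level l. The arcs into a level carry its M, and so do the arcs
-- out of it, so both sides are the sum of M over all levels. For an indicator χ this is the mass
-- balance of a set of vertices.
mass-conservation : ∀ k (χ : Vertex k → ℕ) (y : Fin (2 ^ k)) →
  χ (y , zero) * 2 ^ k + ∑[ e ∈ edges k ] χ (head e) * mass e y
  ≡ ∑[ e ∈ edges k ] χ (tail e) * mass e y + ∑[ w ∈ allFin (2 ^ k) ] χ (w , fromℕ k)
mass-conservation k χ y = begin
  χ (y , zero) * 2 ^ k + ∑[ e ∈ edges k ] χ (head e) * mass e y   ≡⟨ cong₂ _+_ (sym at-inputs) at-heads ⟩
  M zero + ∑[ l ∈ allFin k ] M (suc l)                             ≡⟨ ∑-telescope M ⟩
  ∑[ l ∈ allFin k ] M (inject₁ l) + M (fromℕ k)                    ≡⟨ cong₂ _+_ (sym at-tails) at-outputs ⟩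
  ∑[ e ∈ edges k ] χ (tail e) * mass e y + ∑[ w ∈ allFin (2 ^ k) ] χ (w , fromℕ k) ∎
  where
    open ≡-Reasoning
    ws = allFin (2 ^ k)
    M : Fin (suc k) → ℕ
    M l = ∑[ w ∈ ws ] χ (w , l) * vertexMass (w , l) y
    at-inputs : M zero ≡ χ (y , zero) * 2 ^ k
    at-inputs = trans (∑-cong λ w → trans (regroup (χ (w , zero)) (2 ^ k) ⟦ toℕ y ≟ toℕ w ⟧)
        (cong (_* (χ (w , zero) * 2 ^ k)) (⟦⟧-cong (toℕ y ≟ toℕ w) (y Fin.≟ w) toℕ-injective (cong toℕ))))
      (∑-δ y (λ w → χ (w , zero) * 2 ^ k))
      where
        regroup : ∀ a b c → a * (b * c) ≡ c * (a * b)
        regroup = solve-∀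
    at-outputs : M (fromℕ k) ≡ ∑[ w ∈ ws ] χ (w , fromℕ k)
    at-outputs = ∑-cong λ w → trans (cong (χ (w , fromℕ k) *_) (unit w)) (*-identityʳ _)
      where
        unit : ∀ w → vertexMass (w , fromℕ k) y ≡ 1
        unit w rewrite toℕ-fromℕ k | n∸n≡0 k | shift-< k (toℕ y) (toℕ<n y) | shift-< k (toℕ w) (toℕ<n w) = refl
    at-heads : ∑[ e ∈ edges k ] χ (head e) * mass e y ≡ ∑[ l ∈ allFin k ] M (suc l)
    at-heads = trans (∑-edges k _) (∑-cong λ l → begin
      ∑[ w ∈ ws ] (χ (w , suc l) * mass (l , w , false) y + χ (flipFin l w , suc l) * mass (l , w , true) y)
        ≡⟨ ∑-+ ⟩
      ∑[ w ∈ ws ] χ (w , suc l) * mass (l , w , false) y + ∑[ w ∈ ws ] χ (flipFin l w , suc l) * mass (l , w , true) y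
        -- The flipped arcs are indexed by their heads instead of their tails.
        ≡⟨ cong (∑[ w ∈ ws ] χ (w , suc l) * mass (l , w , false) y +_) (∑-involution (flipFin l) (flipFin-involutive l) _) ⟨
      ∑[ w ∈ ws ] χ (w , suc l) * mass (l , w , false) y
        + ∑[ w ∈ ws ] χ (flipFin l (flipFin l w) , suc l) * mass (l , flipFin l w , true) y
        ≡⟨ ∑-+ ⟨
      ∑[ w ∈ ws ] (χ (w , suc l) * mass (l , w , false) y
                   + χ (flipFin l (flipFin l w) , suc l) * mass (l , flipFin l w , true) y)
        ≡⟨ (∑-cong λ w → trans (cong (λ v → χ (w , suc l) * mass (l , w , false) y + χ (v , suc l) * mass (l , flipFin l w , true) y)
                                    (flipFin-involutive l w))
                         (trans (sym (*-distribˡ-+ (χ (w , suc l)) _ _)) (cong (χ (w , suc l) *_) (mass-in l w y)))) ⟩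
      M (suc l) ∎)
    at-tails : ∑[ e ∈ edges k ] χ (tail e) * mass e y ≡ ∑[ l ∈ allFin k ] M (inject₁ l)
    at-tails = trans (∑-edges k _) (∑-cong λ l → ∑-cong λ w →
      trans (double (χ (w , inject₁ l)) (mass (l , w , false) y)) (cong (χ (w , inject₁ l) *_) (mass-out l w false y)))
      where
        double : ∀ a b → a * b + a * b ≡ a * (2 * b)
        double = solve-∀

-- Counting arcs by their tails

_≟ᵛ_ : ∀ {k} (u v : Vertex k) → Dec (u ≡ v)
_≟ᵛ_ = ≡-dec Fin._≟_ Fin._≟_

-- The tail fixes the level and the wire of an arc and leaves only the choice of keeping or flipping
-- the bit. Outputs have no outgoing arc, hence an inequality.
outdegree : ∀ {k} (v : Vertex k) → ∑[ e ∈ edges k ] ⟦ tail e ≟ᵛ v ⟧ ≤ 2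
outdegree {k} (w₀ , l₀) = begin
  ∑[ e ∈ edges k ] ⟦ tail e ≟ᵛ (w₀ , l₀) ⟧
    ≡⟨ ∑-edges k _ ⟩
  ∑[ l ∈ allFin k ] ∑[ w ∈ ws ] (⟦ (w , inject₁ l) ≟ᵛ (w₀ , l₀) ⟧ + ⟦ (w , inject₁ l) ≟ᵛ (w₀ , l₀) ⟧)
    ≤⟨ (∑-mono λ l → ∑-mono λ w → +-mono-≤ (factor l w) (factor l w)) ⟩
  ∑[ l ∈ allFin k ] ∑[ w ∈ ws ] (⟦ w₀ Fin.≟ w ⟧ * ⟦ l₀ Fin.≟ inject₁ l ⟧ + ⟦ w₀ Fin.≟ w ⟧ * ⟦ l₀ Fin.≟ inject₁ l ⟧)
    ≡⟨ (∑-cong λ l → trans ∑-+ (cong₂ _+_ (∑-δ w₀ _) (∑-δ w₀ _))) ⟩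
  ∑[ l ∈ allFin k ] (⟦ l₀ Fin.≟ inject₁ l ⟧ + ⟦ l₀ Fin.≟ inject₁ l ⟧)
    ≡⟨ ∑-+ ⟩
  ∑[ l ∈ allFin k ] ⟦ l₀ Fin.≟ inject₁ l ⟧ + ∑[ l ∈ allFin k ] ⟦ l₀ Fin.≟ inject₁ l ⟧
    ≤⟨ +-mono-≤ one one ⟩
  2 ∎
  where
    open ≤-Reasoning
    ws = allFin (2 ^ k)
    factor : ∀ l w → ⟦ (w , inject₁ l) ≟ᵛ (w₀ , l₀) ⟧ ≤ ⟦ w₀ Fin.≟ w ⟧ * ⟦ l₀ Fin.≟ inject₁ l ⟧
    factor l w with (w , inject₁ l) ≟ᵛ (w₀ , l₀)
    ... | no _ = z≤n
    ... | yes refl rewrite ⟦⟧-yes (w Fin.≟ w) refl | ⟦⟧-yes (inject₁ l Fin.≟ inject₁ l) refl = ≤-refl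
    one : ∑[ l ∈ allFin k ] ⟦ l₀ Fin.≟ inject₁ l ⟧ ≤ 1
    one = begin
      ∑[ l ∈ allFin k ] ⟦ l₀ Fin.≟ inject₁ l ⟧                         ≤⟨ m≤m+n _ _ ⟩
      ∑[ l ∈ allFin k ] ⟦ l₀ Fin.≟ inject₁ l ⟧ + ⟦ l₀ Fin.≟ fromℕ k ⟧   ≡⟨ ∑-allFin-last (λ l → ⟦ l₀ Fin.≟ l ⟧) ⟨
      ∑[ l ∈ allFin (suc k) ] ⟦ l₀ Fin.≟ l ⟧                           ≡⟨ (∑-cong λ l → *-identityʳ _) ⟨
      ∑[ l ∈ allFin (suc k) ] ⟦ l₀ Fin.≟ l ⟧ * 1                       ≡⟨ ∑-δ l₀ (λ _ → 1) ⟩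
      1                                                                ∎

∑-mass : ∀ {k} (c : Edge k → ℕ) →
         2 * (∑[ y ∈ allFin (2 ^ k) ] ∑[ e ∈ edges k ] c e * mass e y) ≡ ∑ (edges k) c * 2 ^ k
∑-mass {k} c = begin
  2 * (∑[ y ∈ allFin (2 ^ k) ] ∑[ e ∈ edges k ] c e * mass e y)   ≡⟨ cong (2 *_) ∑-swap ⟩
  2 * (∑[ e ∈ edges k ] ∑[ y ∈ allFin (2 ^ k) ] c e * mass e y)   ≡⟨ ∑-*ˡ 2 ⟨
  ∑[ e ∈ edges k ] 2 * (∑[ y ∈ allFin (2 ^ k) ] c e * mass e y)   ≡⟨ (∑-cong λ e →
      trans (cong (2 *_) (∑-*ˡ (c e))) (trans (commute (c e) _) (cong (c e *_) (mass-total e)))) ⟩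
  ∑[ e ∈ edges k ] c e * 2 ^ k                                    ≡⟨ ∑-*ʳ (2 ^ k) ⟩
  ∑ (edges k) c * 2 ^ k                                           ∎
  where
    open ≡-Reasoning
    commute : ∀ c m → 2 * (c * m) ≡ c * (2 * m)
    commute = solve-∀

-- A telescoping estimate, applied both to the levels of a straight path and to the sequence of
-- supersteps.
descend : ∀ {n} (f : Fin (suc n) → ℕ) (g : Fin n → ℕ) → (∀ i → f (inject₁ i) ≤ f (suc i) + g i) →
          ∀ i → f zero ≤ f i + ∑ (allFin n) g
descend f g le zero = m≤m+n _ _
descend {suc n} f g le (suc i) = begin
  f zero                                           ≤⟨ le zero ⟩
  f (suc zero) + g zero                            ≤⟨ +-monoˡ-≤ (g zero) (descend (f ∘ suc) (g ∘ suc) (le ∘ suc) i) ⟩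
  f (suc i) + ∑ (allFin n) (g ∘ suc) + g zero      ≡⟨ +-assoc (f (suc i)) _ _ ⟩
  f (suc i) + (∑ (allFin n) (g ∘ suc) + g zero)    ≡⟨ cong (f (suc i) +_) (trans (+-comm _ (g zero)) (sym (∑-allFin-suc g))) ⟩
  f (suc i) + ∑ (allFin (suc n)) g                 ∎
  where open ≤-Reasoning

foldr-⊔-∈ : {X : Set} {xs : List X} {x : X} (f : X → ℕ) → x ∈ xs → f x ≤ foldr _⊔_ 0 (map f xs)
foldr-⊔-∈ f (here refl) = m≤m⊔n _ _
foldr-⊔-∈ {xs = y ∷ _} f (there x∈) = ≤-trans (foldr-⊔-∈ f x∈) (m≤n⊔m (f y) _)

-- Charge each counted arc to a message that carries the value of its tail. A message carries a
-- single value, so it is charged by at most two arcs.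
tail-count : ∀ {k} {M : Set} (value : M → Vertex k) {Q : M → Set} (Q? : ∀ m → Dec (Q m)) (ms : List M) (c : Edge k → ℕ) →
             (∀ e → c e ≡ 0 ⊎ (c e ≡ 1 × Σ M λ m → m ∈ ms × Q m × tail e ≡ value m)) →
             ∑ (edges k) c ≤ 2 * length (filter Q? ms)
tail-count {k} value Q? ms c witness = begin
  ∑ (edges k) c                                                       ≤⟨ ∑-mono bound ⟩
  ∑[ e ∈ edges k ] ∑[ m ∈ ms ] ⟦ Q? m ⟧ * ⟦ tail e ≟ᵛ value m ⟧       ≡⟨ ∑-swap ⟩
  ∑[ m ∈ ms ] ∑[ e ∈ edges k ] ⟦ Q? m ⟧ * ⟦ tail e ≟ᵛ value m ⟧       ≡⟨ (∑-cong λ m → ∑-*ˡ ⟦ Q? m ⟧) ⟩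
  ∑[ m ∈ ms ] ⟦ Q? m ⟧ * (∑[ e ∈ edges k ] ⟦ tail e ≟ᵛ value m ⟧)     ≤⟨ (∑-mono λ m → *-monoʳ-≤ ⟦ Q? m ⟧ (outdegree (value m))) ⟩
  ∑[ m ∈ ms ] ⟦ Q? m ⟧ * 2                                            ≡⟨ ∑-*ʳ 2 ⟩
  (∑[ m ∈ ms ] ⟦ Q? m ⟧) * 2                                          ≡⟨ *-comm (∑[ m ∈ ms ] ⟦ Q? m ⟧) 2 ⟩
  2 * (∑[ m ∈ ms ] ⟦ Q? m ⟧)                                          ≡⟨ cong (2 *_) (length-filter-∑ Q? ms) ⟨
  2 * length (filter Q? ms)                                           ∎
  where
    open ≤-Reasoning
    bound : ∀ e → c e ≤ ∑[ m ∈ ms ] ⟦ Q? m ⟧ * ⟦ tail e ≟ᵛ value m ⟧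
    bound e with witness e
    ... | inj₁ eq = ≤-trans (≤-reflexive eq) z≤n
    ... | inj₂ (eq , m , m∈ , q , at-m) = ≤-trans
      (≤-reflexive (trans eq (sym (cong₂ _*_ (⟦⟧-yes (Q? m) q) (⟦⟧-yes (tail e ≟ᵛ value m) at-m)))))
      (∑-∈ (λ m → ⟦ Q? m ⟧ * ⟦ tail e ≟ᵛ value m ⟧) m∈)

φ-scale : ∀ c x → c ≤ 1 → c * φ x ≡ φ (c * x)
φ-scale zero x _ = refl
φ-scale (suc zero) x _ = trans (+-identityʳ (φ x)) (cong φ (sym (+-identityʳ x)))
φ-scale (suc (suc _)) x (s≤s ())

-- Transfers of mass between processors

module Analysis {k p : ℕ} (A : BSPAlg k p) (valid : Valid A) where
  open BSPAlg A
  open Valid valid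

  -- The origin of the values that processors use

  owner : Vertex k → Fin p
  owner (w , zero) = place w
  owner (w , suc l) = proc (w , suc l)

  -- Superstep t ends at time suc t; inputs are ready at time 0.
  ready : Vertex k → ℕ
  ready (w , zero) = 0
  ready (w , suc l) = suc (toℕ (step (w , suc l)))

  owner-input : ∀ u → IsInput u → owner u ≡ place (proj₁ u)
  owner-input (w , zero) _ = refl

  owner-computed : ∀ u → ¬ IsInput u → owner u ≡ proc u
  owner-computed (w , zero) ¬in = contradiction refl ¬in
  owner-computed (w , suc l) _ = refl

  ready-input : ∀ u → IsInput u → ready u ≡ 0
  ready-input (w , zero) _ = refl

  ready-computed : ∀ u → ¬ IsInput u → ready u ≡ suc (toℕ (step u))
  ready-computed (w , zero) ¬in = contradiction refl ¬in
  ready-computed (w , suc l) _ = refl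

  SentByOwner : Vertex k → Fin T → Set
  SentByOwner u t = ready u ≤ suc (toℕ t) × Σ (Fin p) λ R → (owner u , R , u) ∈ msgs t

  -- A sender that does not own u must have received it in an earlier superstep. Tracing this back,
  -- by induction on the bound b of t, ends at a message sent by the owner.
  origin : ∀ b t Q R u → toℕ t < b → (Q , R , u) ∈ msgs t →
           Σ (Fin T) λ t₀ → toℕ t₀ ≤ toℕ t × SentByOwner u t₀
  origin (suc b) t Q R u (s≤s t≤b) m with send-ok t Q R u m
  ... | inj₁ (in-u , eq) = t , ≤-refl , ≤-trans (≤-reflexive (ready-input u in-u)) z≤n , R ,
        subst (λ o → (o , R , u) ∈ msgs t) (sym (trans (owner-input u in-u) eq)) m
  ... | inj₂ (inj₁ (¬in , eq , le)) = t , ≤-refl , ≤-trans (≤-reflexive (ready-computed u ¬in)) (s≤s le) , R ,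
        subst (λ o → (o , R , u) ∈ msgs t) (sym (trans (owner-computed u ¬in) eq)) m
  ... | inj₂ (inj₂ (t' , t'<t , Q' , m')) with origin b t' Q' Q u (≤-trans t'<t t≤b) m'
  ...   | t₀ , t₀≤t' , sent = t₀ , ≤-trans t₀≤t' (<⇒≤ t'<t) , sent

  -- A remote value may be relayed. Only the two ends of the relay chain are kept: the message from
  -- the owner of the tail, to be charged to the sender, and the message to the owner of the head,
  -- to be charged to the receiver.
  data Dependency (e : Edge k) : Set where
    local : owner (tail e) ≡ owner (head e) → ready (tail e) ≤ ready (head e) → Dependency e
    remote : ∀ t₀ → SentByOwner (tail e) t₀ → suc (toℕ t₀) < ready (head e) →
             ∀ t Q → (Q , owner (head e) , tail e) ∈ msgs t → Dependency e

  dependency : ∀ e → Dependency e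
  dependency e@(l , w , d) with compute-ok (head e) (λ ()) (tail e) (edge-Arc e)
  ... | inj₁ (in-u , eq) = local (trans (owner-input (tail e) in-u) eq)
        (≤-trans (≤-reflexive (ready-input (tail e) in-u)) z≤n)
  ... | inj₂ (inj₁ (¬in , eq , before)) = local (trans (owner-computed (tail e) ¬in) eq)
        (≤-trans (≤-reflexive (ready-computed (tail e) ¬in))
          (s≤s ([ <⇒≤ , (λ { (eq' , _) → ≤-reflexive (cong toℕ eq') }) ]′ before)))
  ... | inj₂ (inj₂ (t , t<s , Q , m)) with origin (suc (toℕ t)) t Q _ (tail e) ≤-refl m
  ...   | t₀ , t₀≤t , sent = remote t₀ sent (s≤s (≤-trans (s≤s t₀≤t) t<s)) t Q m

  local? : ∀ e → Dec (owner (tail e) ≡ owner (head e))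
  local? e = owner (tail e) Fin.≟ owner (head e)

  -- Decided by the owners, not by the constructor of `dependency e`, because a processor may also
  -- receive a value that it owns itself.
  crossing : Edge k → ℕ
  crossing e = ⟦ ¬? (local? e) ⟧

  departureOf : ∀ {e} → Dependency e → ℕ
  -- A default value: such an arc does not cross, and departures count only for crossing arcs.
  departureOf (local _ _) = 0
  departureOf (remote t₀ _ _ _ _ _) = toℕ t₀

  departure : Edge k → ℕ
  departure e = departureOf (dependency e)

  ready-mono : ∀ e → ready (tail e) ≤ ready (head e)
  ready-mono e with dependency e
  ... | local _ le = le
  ... | remote _ (r , _) lt _ _ _ = ≤-trans r (<⇒≤ lt)

  module _ (e : Edge k) (cross : owner (tail e) ≢ owner (head e)) where

    ready-tail≤ : ready (tail e) ≤ suc (departure e)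
    ready-tail≤ with dependency e
    ... | local eq _ = contradiction eq cross
    ... | remote _ (r , _) _ _ _ _ = r

    <ready-head : suc (departure e) < ready (head e)
    <ready-head with dependency e
    ... | local eq _ = contradiction eq cross
    ... | remote _ _ lt _ _ _ = lt

    departure-msg : Σ (Fin T) λ t → toℕ t ≡ departure e × Σ (Fin p) λ R → (owner (tail e) , R , tail e) ∈ msgs t
    departure-msg with dependency e
    ... | local eq _ = contradiction eq cross
    ... | remote t₀ (_ , s) _ _ _ _ = t₀ , refl , s

    arrival-msg : Σ (Fin T) λ t → Σ (Fin p) λ Q → (Q , owner (head e) , tail e) ∈ msgs t
    arrival-msg with dependency e
    ... | local eq _ = contradiction eq cross
    ... | remote _ _ _ t Q m = t , Q , m

    departure<T : departure e < T
    departure<T with departure-msg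
    ... | t , eq , _ = subst (_< T) eq (toℕ<n t)

  -- Mass flows and the balance of each processor

  ∑p : (Fin p → ℕ) → ℕ
  ∑p = ∑ (allFin p)

  ∑n : (Fin (2 ^ k) → ℕ) → ℕ
  ∑n = ∑ (allFin (2 ^ k))

  inputs outputs : Fin p → ℕ
  inputs P = ∑n λ w → ⟦ place w Fin.≟ P ⟧
  outputs P = ∑n λ w → ⟦ owner (w , fromℕ k) Fin.≟ P ⟧

  before at : ℕ → Edge k → ℕ
  before t e = crossing e * ⟦ departure e <? t ⟧
  at t e = crossing e * ⟦ departure e ≟ t ⟧

  enter leave : Fin p → (Edge k → ℕ) → Edge k → ℕ
  enter P c e = ⟦ owner (head e) Fin.≟ P ⟧ * c e
  leave P c e = ⟦ owner (tail e) Fin.≟ P ⟧ * c e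

  inflow outflow : Fin p → (Edge k → ℕ) → Fin (2 ^ k) → ℕ
  inflow P c y = ∑[ e ∈ edges k ] enter P c e * mass e y
  outflow P c y = ∑[ e ∈ edges k ] leave P c e * mass e y

  initial : Fin p → Fin (2 ^ k) → ℕ
  initial P y = ⟦ place y Fin.≟ P ⟧ * 2 ^ k

  before-suc : ∀ t e → before (suc t) e ≡ before t e + at t e
  before-suc t e = trans (cong (crossing e *_)
      (⟦⟧-⊎ (departure e <? suc t) (departure e <? t) (departure e ≟ t)
        (λ lt → m≤n⇒m<n∨m≡n (≤-pred lt)) m<n⇒m<1+n (λ { refl → ≤-refl }) (λ { lt refl → <-irrefl refl lt })))
    (*-distribˡ-+ (crossing e) _ _)

  private
    flow-suc : ∀ (o : Edge k → ℕ) y t →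
      ∑[ e ∈ edges k ] (o e * before (suc t) e) * mass e y
      ≡ ∑[ e ∈ edges k ] (o e * before t e) * mass e y + ∑[ e ∈ edges k ] (o e * at t e) * mass e y
    flow-suc o y t = trans (∑-cong λ e → trans (cong (λ c → o e * c * mass e y) (before-suc t e))
        (distrib (o e) (before t e) (at t e) (mass e y))) ∑-+
      where
        distrib : ∀ o a b m → o * (a + b) * m ≡ o * a * m + o * b * m
        distrib = solve-∀

  inflow-suc : ∀ P t y → inflow P (before (suc t)) y ≡ inflow P (before t) y + inflow P (at t) y
  inflow-suc P t y = flow-suc (λ e → ⟦ owner (head e) Fin.≟ P ⟧) y t

  outflow-suc : ∀ P t y → outflow P (before (suc t)) y ≡ outflow P (before t) y + outflow P (at t) y
  outflow-suc P t y = flow-suc (λ e → ⟦ owner (tail e) Fin.≟ P ⟧) y t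

  private
    sum-scale : ∀ (f g : Edge k → ℕ) y →
      ∑[ e ∈ edges k ] f e * mass e y + ∑[ e ∈ edges k ] g e * mass e y ≡ ∑[ e ∈ edges k ] (f e + g e) * mass e y
    sum-scale f g y = trans (sym ∑-+) (∑-cong λ e → sym (*-distribʳ-+ (mass e y) (f e) (g e)))

  -- Mass balance for the vertices of P that are ready at the end of superstep t.
  outflow-bounded : ∀ P t y → outflow P (before (suc t)) y ≤ initial P y + inflow P (before t) y
  outflow-bounded P t y = +-cancelˡ-≤ heads _ _ (begin
      heads + outflow P (before (suc t)) y                     ≡⟨ sum-scale (χ ∘ head) (leave P (before (suc t))) y ⟩
      ∑[ e ∈ edges k ] (χ (head e) + leave P (before (suc t)) e) * mass e y
                                                               ≤⟨ (∑-mono λ e → *-monoˡ-≤ (mass e y) (pointwise e)) ⟩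
      ∑[ e ∈ edges k ] (χ (tail e) + enter P (before t) e) * mass e y
                                                               ≡⟨ sum-scale (χ ∘ tail) (enter P (before t)) y ⟨
      tails + inflow P (before t) y                            ≤⟨ +-monoˡ-≤ _ (≤-trans (m≤m+n tails _) (≤-reflexive (sym (mass-conservation k χ y)))) ⟩
      χ (y , zero) * 2 ^ k + heads + inflow P (before t) y     ≤⟨ +-monoˡ-≤ _ (+-monoˡ-≤ heads (*-monoˡ-≤ (2 ^ k) (*-monoʳ-≤ ⟦ place y Fin.≟ P ⟧ (⟦⟧≤1 (0 ≤? suc t))))) ⟩
      ⟦ place y Fin.≟ P ⟧ * 1 * 2 ^ k + heads + inflow P (before t) y
                                                               ≡⟨ regroup ⟦ place y Fin.≟ P ⟧ (2 ^ k) heads _ ⟩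
      heads + (initial P y + inflow P (before t) y)            ∎)
    where
      open ≤-Reasoning
      χ : Vertex k → ℕ
      χ v = ⟦ owner v Fin.≟ P ⟧ * ⟦ ready v ≤? suc t ⟧
      heads = ∑[ e ∈ edges k ] χ (head e) * mass e y
      tails = ∑[ e ∈ edges k ] χ (tail e) * mass e y
      regroup : ∀ a b c d → a * 1 * b + c + d ≡ c + (a * b + d)
      regroup = solve-∀
      -- On a local arc the tail is ready when the head is. On a crossing arc, departure in
      -- superstep t requires a ready tail, whereas a head ready by the end of superstep t requires
      -- departure before t; hence the shift between `suc t` and `t`.
      pointwise : ∀ e → χ (head e) + leave P (before (suc t)) e ≤ χ (tail e) + enter P (before t) e
      pointwise e with local? e
      ... | yes eq rewrite *-zeroʳ ⟦ owner (tail e) Fin.≟ P ⟧ | *-zeroʳ ⟦ owner (head e) Fin.≟ P ⟧ =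
        +-monoˡ-≤ 0 (*-mono-≤
          (⟦⟧-mono (owner (head e) Fin.≟ P) (owner (tail e) Fin.≟ P) (trans eq))
          (⟦⟧-mono (ready (head e) ≤? suc t) (ready (tail e) ≤? suc t) (≤-trans (ready-mono e))))
      ... | no cross rewrite *-identityˡ ⟦ departure e <? t ⟧ | *-identityˡ ⟦ departure e <? suc t ⟧ =
        ≤-trans (≤-reflexive (+-comm (χ (head e)) _)) (+-mono-≤
          (*-monoʳ-≤ ⟦ owner (tail e) Fin.≟ P ⟧ (⟦⟧-mono (departure e <? suc t) (ready (tail e) ≤? suc t)
            (λ lt → ≤-trans (ready-tail≤ e cross) lt)))
          (*-monoʳ-≤ ⟦ owner (head e) Fin.≟ P ⟧ (⟦⟧-mono (ready (head e) ≤? suc t) (departure e <? t)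
            (λ le → ≤-pred (≤-trans (<ready-head e cross) le)))))

  -- Conservation for the set of all vertices of P. Every crossing arc departs before time T, so the
  -- estimate of `outflow-bounded` becomes an equality.
  final-balance : ∀ P y → initial P y + inflow P (before T) y ≡ outflow P (before T) y + outputs P
  final-balance P y = +-cancelʳ-≡ (heads + tails) _ _ (begin
      initial P y + inflow P (before T) y + (heads + tails)         ≡⟨ regroup (initial P y) _ heads tails ⟩
      (initial P y + heads) + (tails + inflow P (before T) y)       ≡⟨ cong₂ _+_ (mass-conservation k χ y) (sum-scale (χ ∘ tail) _ y) ⟩
      (tails + outputs P) + (∑[ e ∈ edges k ] (χ (tail e) + enter P (before T) e) * mass e y)
                                                                    ≡⟨ cong (tails + outputs P +_) (∑-cong λ e → cong (_* mass e y) (pointwise e)) ⟨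
      (tails + outputs P) + (∑[ e ∈ edges k ] (χ (head e) + leave P (before T) e) * mass e y)
                                                                    ≡⟨ cong (tails + outputs P +_) (sum-scale (χ ∘ head) _ y) ⟨
      (tails + outputs P) + (heads + outflow P (before T) y)        ≡⟨ regroup' tails (outputs P) heads _ ⟩
      outflow P (before T) y + outputs P + (heads + tails)          ∎)
    where
      open ≡-Reasoning
      χ : Vertex k → ℕ
      χ v = ⟦ owner v Fin.≟ P ⟧
      heads = ∑[ e ∈ edges k ] χ (head e) * mass e y
      tails = ∑[ e ∈ edges k ] χ (tail e) * mass e y
      regroup : ∀ a b c d → a + b + (c + d) ≡ (a + c) + (d + b)
      regroup = solve-∀
      regroup' : ∀ a b c d → a + b + (c + d) ≡ d + b + (c + a)
      regroup' = solve-∀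
      pointwise : ∀ e → χ (head e) + leave P (before T) e ≡ χ (tail e) + enter P (before T) e
      pointwise e with local? e
      ... | yes eq rewrite *-zeroʳ ⟦ owner (tail e) Fin.≟ P ⟧ | *-zeroʳ ⟦ owner (head e) Fin.≟ P ⟧ =
        cong (λ o → ⟦ o Fin.≟ P ⟧ + 0) (sym eq)
      ... | no cross rewrite ⟦⟧-yes (departure e <? T) (departure<T e cross)
                           | *-identityʳ ⟦ owner (tail e) Fin.≟ P ⟧ | *-identityʳ ⟦ owner (head e) Fin.≟ P ⟧ =
        +-comm ⟦ owner (head e) Fin.≟ P ⟧ _

  -- P holds this much of the mass of input y before superstep t, if the mass on a crossing arc
  -- is handed over when the owner of its tail sends it.
  held : Fin p → ℕ → Fin (2 ^ k) → ℕ
  held P t y = (initial P y + inflow P (before t) y) ∸ outflow P (before t) y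

  -- The subtraction in `held` is never truncated, thanks to `outflow-bounded`.
  held+outflow : ∀ P t y → held P t y + outflow P (before t) y ≡ initial P y + inflow P (before t) y
  held+outflow P t y = m∸n+n≡m (≤-trans (m≤m+n _ (outflow P (at t) y))
    (≤-trans (≤-reflexive (sym (outflow-suc P t y))) (outflow-bounded P t y)))

  -- Mass that arrives in superstep t cannot be passed on in the same superstep: this is what the
  -- shift of time in `outflow-bounded` provides.
  departing≤held : ∀ P t y → outflow P (at t) y ≤ held P t y
  departing≤held P t y = m+n≤o⇒m≤o∸n (outflow P (at t) y)
    (≤-trans (≤-reflexive (trans (+-comm (outflow P (at t) y) _) (sym (outflow-suc P t y)))) (outflow-bounded P t y))

  held-suc : ∀ P t y → held P (suc t) y ≡ (held P t y ∸ outflow P (at t) y) + inflow P (at t) y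
  held-suc P t y = +-cancelʳ-≡ (outflow P (before t) y + outflow P (at t) y) _ _ (begin
    held P (suc t) y + (outflow P (before t) y + outflow P (at t) y)  ≡⟨ cong (held P (suc t) y +_) (outflow-suc P t y) ⟨
    held P (suc t) y + outflow P (before (suc t)) y                   ≡⟨ held+outflow P (suc t) y ⟩
    initial P y + inflow P (before (suc t)) y                         ≡⟨ cong (initial P y +_) (inflow-suc P t y) ⟩
    initial P y + (inflow P (before t) y + inflow P (at t) y)         ≡⟨ +-assoc (initial P y) _ _ ⟨
    initial P y + inflow P (before t) y + inflow P (at t) y           ≡⟨ cong (_+ inflow P (at t) y) (held+outflow P t y) ⟨
    held P t y + outflow P (before t) y + inflow P (at t) y           ≡⟨ cong (λ x → x + outflow P (before t) y + inflow P (at t) y) (m∸n+n≡m (departing≤held P t y)) ⟨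
    held P t y ∸ outflow P (at t) y + outflow P (at t) y + outflow P (before t) y + inflow P (at t) y
                                                                      ≡⟨ regroup (held P t y ∸ outflow P (at t) y) _ _ _ ⟩
    held P t y ∸ outflow P (at t) y + inflow P (at t) y + (outflow P (before t) y + outflow P (at t) y) ∎)
    where
      open ≡-Reasoning
      regroup : ∀ a b c d → a + b + c + d ≡ a + d + (c + b)
      regroup = solve-∀

  before-0 : ∀ e → before 0 e ≡ 0
  before-0 e = trans (cong (crossing e *_) (⟦⟧-no (departure e <? 0) n≮0)) (*-zeroʳ (crossing e))

  held-0 : ∀ P y → held P 0 y ≡ initial P y
  held-0 P y = cong₂ _∸_ (trans (cong (initial P y +_) (∑-0 λ e → none ⟦ owner (head e) Fin.≟ P ⟧ e)) (+-identityʳ (initial P y)))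
                         (∑-0 λ e → none ⟦ owner (tail e) Fin.≟ P ⟧ e)
    where
      none : ∀ o e → o * before 0 e * mass e y ≡ 0
      none o e rewrite before-0 e | *-zeroʳ o = refl

  -- At the end all mass rests on the outputs, one unit of every input on each, so the amount does
  -- not depend on y.
  held-T : ∀ P y → held P T y ≡ outputs P
  held-T P y = trans (cong (_∸ outflow P (before T) y) (final-balance P y)) (m+n∸m≡n (outflow P (before T) y) (outputs P))

  ∑-processors : (o : Edge k → Fin p) (c f : Edge k → ℕ) →
                 ∑p (λ P → ∑[ e ∈ edges k ] ⟦ o e Fin.≟ P ⟧ * c e * f e) ≡ ∑[ e ∈ edges k ] c e * f e
  ∑-processors o c f = trans ∑-swap (∑-cong λ e →
    trans (∑-cong λ P → *-assoc ⟦ o e Fin.≟ P ⟧ (c e) (f e)) (∑-δ (o e) (λ _ → c e * f e)))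

  -- Each departed arc is counted once in an inflow and once in an outflow, so transfers cancel in
  -- the sum over processors.
  held-total : ∀ t y → ∑p (λ P → held P t y) ≡ 2 ^ k
  held-total t y = +-cancelʳ-≡ (∑p λ P → outflow P (before t) y) _ _ (begin
    ∑p (λ P → held P t y) + ∑p (λ P → outflow P (before t) y)    ≡⟨ ∑-+ ⟨
    ∑p (λ P → held P t y + outflow P (before t) y)               ≡⟨ (∑-cong λ P → held+outflow P t y) ⟩
    ∑p (λ P → initial P y + inflow P (before t) y)               ≡⟨ ∑-+ ⟩
    ∑p (λ P → initial P y) + ∑p (λ P → inflow P (before t) y)    ≡⟨ cong₂ _+_ (∑-δ (place y) (λ _ → 2 ^ k)) (∑-processors (owner ∘ head) (before t) (λ e → mass e y)) ⟩
    2 ^ k + ∑[ e ∈ edges k ] before t e * mass e y               ≡⟨ cong (2 ^ k +_) (∑-processors (owner ∘ tail) (before t) (λ e → mass e y)) ⟨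
    2 ^ k + ∑p (λ P → outflow P (before t) y)                    ∎)
    where open ≡-Reasoning

  -- Isoperimetry

  n : ℕ
  n = 2 ^ k

  H-∑ : H A ≡ ∑ (allFin T) (h A)
  H-∑ = sym (∑-def (allFin T) (h A))

  sent≤h : ∀ t P → sent A t P ≤ h A t
  sent≤h t P = ≤-trans (m≤m⊔n (sent A t P) _) (foldr-⊔-∈ (λ P → sent A t P ⊔ received A t P) (∈-allFin P))

  received≤h : ∀ t P → received A t P ≤ h A t
  received≤h t P = ≤-trans (m≤n⊔m (sent A t P) _) (foldr-⊔-∈ (λ P → sent A t P ⊔ received A t P) (∈-allFin P))

  Message : Set
  Message = Fin p × Fin p × Vertex k

  value : Message → Vertex k
  value m = proj₂ (proj₂ m)

  allMsgs : List Message
  allMsgs = concatMap msgs (allFin T)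

  ∈-allMsgs : ∀ {t m} → m ∈ msgs t → m ∈ allMsgs
  ∈-allMsgs {t} {m} m∈ = ∈-concatMap⁺ msgs (Any.map (λ { refl → m∈ }) (∈-allFin t))

  allMsgs-count : {Q : Message → Set} (Q? : ∀ m → Dec (Q m)) →
                  (∀ t → length (filter Q? (msgs t)) ≤ h A t) → length (filter Q? allMsgs) ≤ H A
  allMsgs-count Q? le = begin
    length (filter Q? allMsgs)                       ≡⟨ length-filter-∑ Q? allMsgs ⟩
    ∑[ m ∈ allMsgs ] ⟦ Q? m ⟧                        ≡⟨ ∑-concatMap (allFin T) msgs ⟩
    ∑[ t ∈ allFin T ] ∑[ m ∈ msgs t ] ⟦ Q? m ⟧       ≤⟨ (∑-mono λ t → ≤-trans (≤-reflexive (sym (length-filter-∑ Q? (msgs t)))) (le t)) ⟩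
    ∑ (allFin T) (h A)                               ≡⟨ H-∑ ⟨
    H A                                              ∎
    where open ≤-Reasoning

  -- The departure of an arc is the superstep of a message sent by the owner of its tail, so the
  -- arcs that leave P in superstep t are charged to messages sent by P in t.
  leave-count : ∀ P t → ∑ (edges k) (leave P (at (toℕ t))) ≤ 2 * sent A t P
  leave-count P t = tail-count value (λ m → proj₁ m Fin.≟ P) (msgs t) _ witness
    where
      witness : ∀ e → leave P (at (toℕ t)) e ≡ 0 ⊎ (leave P (at (toℕ t)) e ≡ 1 ×
                Σ Message λ m → m ∈ msgs t × proj₁ m ≡ P × tail e ≡ value m)
      witness e with owner (tail e) Fin.≟ P
      ... | no _ = inj₁ refl
      ... | yes refl with local? e
      ...   | yes _ = inj₁ refl
      ...   | no cross with departure e ≟ toℕ t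
      ...     | no _ = inj₁ refl
      ...     | yes eq with departure-msg e cross
      ...       | t' , eq' , R , m∈ with toℕ-injective (trans eq' eq)
      ...         | refl = inj₂ (refl , _ , m∈ , refl , refl)

  leave-total : ∀ P → ∑ (edges k) (leave P crossing) ≤ 2 * H A
  leave-total P = ≤-trans (tail-count value sent? allMsgs _ witness)
      (*-monoʳ-≤ 2 (allMsgs-count sent? (λ t → sent≤h t P)))
    where
      sent? : (m : Message) → Dec (proj₁ m ≡ P)
      sent? m = proj₁ m Fin.≟ P
      witness : ∀ e → leave P crossing e ≡ 0 ⊎ (leave P crossing e ≡ 1 ×
                Σ Message λ m → m ∈ allMsgs × proj₁ m ≡ P × tail e ≡ value m)
      witness e with owner (tail e) Fin.≟ P
      ... | no _ = inj₁ refl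
      ... | yes refl with local? e
      ...   | yes _ = inj₁ refl
      ...   | no cross with departure-msg e cross
      ...     | t , _ , R , m∈ = inj₂ (refl , _ , ∈-allMsgs m∈ , refl , refl)

  -- Charged to the last message of the relay chain, which P receives; `leave-total` uses the first
  -- one, which P sends.
  enter-total : ∀ P → ∑ (edges k) (enter P crossing) ≤ 2 * H A
  enter-total P = ≤-trans (tail-count value received? allMsgs _ witness)
      (*-monoʳ-≤ 2 (allMsgs-count received? (λ t → received≤h t P)))
    where
      received? : (m : Message) → Dec (proj₁ (proj₂ m) ≡ P)
      received? m = proj₁ (proj₂ m) Fin.≟ P
      witness : ∀ e → enter P crossing e ≡ 0 ⊎ (enter P crossing e ≡ 1 ×
                Σ Message λ m → m ∈ allMsgs × proj₁ (proj₂ m) ≡ P × tail e ≡ value m)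
      witness e with owner (head e) Fin.≟ P
      ... | no _ = inj₁ refl
      ... | yes refl with local? e
      ...   | yes _ = inj₁ refl
      ...   | no cross with arrival-msg e cross
      ...     | t , Q , m∈ = inj₂ (refl , _ , ∈-allMsgs m∈ , refl , refl)

  computedBy-∑ : ∀ P → computedBy A P ≡ ∑[ w ∈ allFin n ] ∑[ l ∈ allFin k ] ⟦ owner (w , suc l) Fin.≟ P ⟧
  computedBy-∑ P = begin
    length (filter proc? (filter computed? (allVertices k)))     ≡⟨ length-filter-∑ proc? _ ⟩
    ∑[ v ∈ filter computed? (allVertices k) ] ⟦ proc? v ⟧         ≡⟨ ∑-filter computed? (allVertices k) ⟩
    ∑[ v ∈ allVertices k ] ⟦ computed? v ⟧ * ⟦ proc? v ⟧          ≡⟨ ∑-concatMap (allFin n) _ ⟩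
    ∑[ w ∈ allFin n ] ∑[ v ∈ map (w ,_) (allFin (suc k)) ] ⟦ computed? v ⟧ * ⟦ proc? v ⟧
      ≡⟨ (∑-cong λ w → trans (∑-map (w ,_) (allFin (suc k))) (trans (∑-allFin-suc _) (∑-cong λ l → +-identityʳ _))) ⟩
    ∑[ w ∈ allFin n ] ∑[ l ∈ allFin k ] ⟦ owner (w , suc l) Fin.≟ P ⟧ ∎
    where
      open ≡-Reasoning
      proc? : (v : Vertex k) → Dec (proc v ≡ P)
      proc? v = proc v Fin.≟ P
      computed? : (v : Vertex k) → Dec (¬ proj₂ v ≡ zero)
      computed? v = ¬? (proj₂ v Fin.≟ zero)

  -- A straight path that starts at an input of P either stays in P or leaves it.
  inputs-bounded : ∀ P → k * inputs P ≤ computedBy A P + k * (2 * H A)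
  inputs-bounded P = begin
    k * inputs P
      ≡⟨ ∑-const k (inputs P) ⟨
    ∑[ l ∈ allFin k ] ∑[ w ∈ allFin n ] ⟦ place w Fin.≟ P ⟧
      ≤⟨ (∑-mono λ l → ∑-mono λ w → descend (λ i → ⟦ owner (w , i) Fin.≟ P ⟧) (exits w) (stay-or-leave w) (suc l)) ⟩
    ∑[ l ∈ allFin k ] ∑[ w ∈ allFin n ] (⟦ owner (w , suc l) Fin.≟ P ⟧ + ∑ (allFin k) (exits w))
      ≡⟨ trans (∑-cong λ l → ∑-+) ∑-+ ⟩
    ∑[ l ∈ allFin k ] ∑[ w ∈ allFin n ] ⟦ owner (w , suc l) Fin.≟ P ⟧
      + ∑[ l ∈ allFin k ] ∑[ w ∈ allFin n ] ∑ (allFin k) (exits w)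
      ≡⟨ cong₂ _+_ (trans ∑-swap (sym (computedBy-∑ P))) (∑-const k _) ⟩
    computedBy A P + k * (∑[ w ∈ allFin n ] ∑ (allFin k) (exits w))
      ≤⟨ +-monoʳ-≤ (computedBy A P) (*-monoʳ-≤ k all-exits) ⟩
    computedBy A P + k * (2 * H A) ∎
    where
      open ≤-Reasoning
      exits : Fin n → Fin k → ℕ
      exits w l = leave P crossing (l , w , false)
      stay-or-leave : ∀ w l → ⟦ owner (w , inject₁ l) Fin.≟ P ⟧ ≤ ⟦ owner (w , suc l) Fin.≟ P ⟧ + exits w l
      stay-or-leave w l with local? (l , w , false)
      ... | yes eq rewrite eq = m≤m+n _ _
      ... | no _ rewrite *-identityʳ ⟦ owner (w , inject₁ l) Fin.≟ P ⟧ = m≤n+m _ _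
      -- Straight paths on distinct wires are disjoint, so their exits are distinct arcs leaving P.
      all-exits : ∑[ w ∈ allFin n ] ∑ (allFin k) (exits w) ≤ 2 * H A
      all-exits = begin
        ∑[ w ∈ allFin n ] ∑ (allFin k) (exits w)     ≡⟨ ∑-swap ⟩
        ∑[ l ∈ allFin k ] ∑[ w ∈ allFin n ] exits w l ≤⟨ (∑-mono λ l → ∑-mono λ w → m≤m+n (exits w l) _) ⟩
        ∑[ l ∈ allFin k ] ∑[ w ∈ allFin n ] (exits w l + leave P crossing (l , w , true))  ≡⟨ ∑-edges k (leave P crossing) ⟨
        ∑ (edges k) (leave P crossing)               ≤⟨ leave-total P ⟩
        2 * H A                                      ∎

  before-T : ∀ e → before T e ≡ crossing e
  before-T e with local? e
  ... | yes _ = refl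
  ... | no cross = trans (+-identityʳ _) (⟦⟧-yes (departure e <? T) (departure<T e cross))

  -- Each output holds one unit of the mass of every input y, all of which must enter P if y does
  -- not start there.
  outputs-bounded : ∀ P → n * outputs P ≤ inputs P * outputs P + H A * n
  outputs-bounded P = begin
    n * outputs P
      ≡⟨ ∑-const n (outputs P) ⟨
    ∑[ y ∈ allFin n ] outputs P
      ≤⟨ ∑-mono own-or-enter ⟩
    ∑[ y ∈ allFin n ] (⟦ place y Fin.≟ P ⟧ * outputs P + inflow P crossing y)
      ≡⟨ trans ∑-+ (cong (_+ ∑ (allFin n) (inflow P crossing)) (∑-*ʳ (outputs P))) ⟩
    inputs P * outputs P + ∑ (allFin n) (inflow P crossing)
      -- At most 2 H arcs enter P, and each brings in n / 2.
      ≤⟨ +-monoʳ-≤ (inputs P * outputs P) (*-cancelˡ-≤ 2 (begin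
          2 * ∑ (allFin n) (inflow P crossing)          ≡⟨ ∑-mass (enter P crossing) ⟩
          ∑ (edges k) (enter P crossing) * n            ≤⟨ *-monoˡ-≤ n (enter-total P) ⟩
          2 * H A * n                                   ≡⟨ *-assoc 2 (H A) n ⟩
          2 * (H A * n)                                 ∎)) ⟩
    inputs P * outputs P + H A * n ∎
    where
      open ≤-Reasoning
      own-or-enter : ∀ y → outputs P ≤ ⟦ place y Fin.≟ P ⟧ * outputs P + inflow P crossing y
      own-or-enter y with place y Fin.≟ P | final-balance P y
      ... | yes _ | _ = ≤-trans (≤-reflexive (sym (+-identityʳ _))) (m≤m+n _ _)
      ... | no _ | balance = begin
        outputs P                                    ≤⟨ m≤n+m _ (outflow P (before T) y) ⟩
        outflow P (before T) y + outputs P           ≡⟨ balance ⟨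
        inflow P (before T) y                        ≡⟨ (∑-cong λ e → cong (λ c → ⟦ owner (head e) Fin.≟ P ⟧ * c * mass e y) (before-T e)) ⟩
        inflow P crossing y                          ∎

  outputs-total : ∑p outputs ≡ n
  outputs-total = begin
    ∑p (λ P → ∑[ w ∈ allFin n ] ⟦ owner (w , fromℕ k) Fin.≟ P ⟧)        ≡⟨ ∑-swap ⟩
    ∑[ w ∈ allFin n ] ∑p (λ P → ⟦ owner (w , fromℕ k) Fin.≟ P ⟧)        ≡⟨ (∑-cong λ w → ∑-cong λ P → *-identityʳ _) ⟨
    ∑[ w ∈ allFin n ] ∑p (λ P → ⟦ owner (w , fromℕ k) Fin.≟ P ⟧ * 1)    ≡⟨ (∑-cong λ w → ∑-δ (owner (w , fromℕ k)) (λ _ → 1)) ⟩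
    ∑[ w ∈ allFin n ] 1                                                 ≡⟨ ∑-const n 1 ⟩
    n * 1                                                               ≡⟨ *-identityʳ n ⟩
    n                                                                   ∎
    where open ≡-Reasoning

  -- The potential

  Φ : ℕ → ℕ
  Φ t = ∑p λ P → ∑[ y ∈ allFin n ] φ (held P t y)

  -- For mass m > 0, the tangent of log₂ at 2 ^ s * m gives m log₂ G ≤ m (log₂ m + s) + G / 2 ^ s,
  -- and m log₂ m is at most `φ m` + 2 m. Everything is multiplied by 2 ^ s; in the end s is
  -- `lg (divℕ n p)`.
  mass-loss : ∀ s (e : Edge k) y G →
    2 ^ s * (mass e y * ⌊log₂ G ⌋) ≤ 2 ^ s * φ (mass e y) + mass e y * (2 ^ s * (s + 2)) + G
  mass-loss s (l , w , d) y G with shift (toℕ l) (toℕ y) ≟ shift (toℕ l) (toℕ w)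
  ... | no _ rewrite *-zeroʳ (2 ^ (k ∸ suc (toℕ l))) = ≤-trans (≤-reflexive (*-zeroʳ (2 ^ s))) z≤n
  ... | yes _ rewrite *-identityʳ (2 ^ (k ∸ suc (toℕ l))) = begin
      2 ^ s * (2 ^ j * ⌊log₂ G ⌋)                                            ≡⟨ trans (sym (*-assoc (2 ^ s) (2 ^ j) _)) (cong (_* ⌊log₂ G ⌋) (sym (^-distribˡ-+-* 2 s j))) ⟩
      2 ^ (s + j) * ⌊log₂ G ⌋                                                ≤⟨ ⌊log₂⌋-tangent (s + j) G ⟩
      2 ^ (s + j) * (s + j) + G                                              ≡⟨ cong (λ x → x * (s + j) + G) (^-distribˡ-+-* 2 s j) ⟩
      2 ^ s * 2 ^ j * (s + j) + G                                            ≡⟨ cong (_+ G) (regroup (2 ^ s) (2 ^ j) s j) ⟩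
      2 ^ s * (2 ^ j * j) + 2 ^ s * 2 ^ j * s + G                            ≤⟨ +-monoˡ-≤ G (+-monoˡ-≤ _ (*-monoʳ-≤ (2 ^ s) (φ-2^ j))) ⟩
      2 ^ s * (φ (2 ^ j) + 2 * 2 ^ j) + 2 ^ s * 2 ^ j * s + G                ≡⟨ cong (_+ G) (regroup' (2 ^ s) (2 ^ j) s (φ (2 ^ j))) ⟩
      2 ^ s * φ (2 ^ j) + 2 ^ j * (2 ^ s * (s + 2)) + G                      ∎
    where
      open ≤-Reasoning
      j = k ∸ suc (toℕ l)
      regroup : ∀ S q s j → S * q * (s + j) ≡ S * (q * j) + S * q * s
      regroup = solve-∀
      regroup' : ∀ S q s f → S * (f + 2 * q) + S * q * s ≡ S * f + q * (S * (s + 2))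
      regroup' = solve-∀

  -- By convexity, sending D out of G lowers `φ` by at most D log₂ G, and arrivals raise it by at
  -- least the `φ` of each arriving mass. The loss is split over the leaving arcs by `mass-loss`;
  -- the terms `φ (mass e y)` stay on both sides to cancel later.
  held-loss : ∀ s P t y →
    2 ^ s * φ (held P t y) + ∑[ e ∈ edges k ] enter P (at t) e * (2 ^ s * φ (mass e y))
    ≤ 2 ^ s * φ (held P (suc t) y)
      + ∑[ e ∈ edges k ] leave P (at t) e * (2 ^ s * φ (mass e y) + mass e y * (2 ^ s * (s + 2)) + held P t y)
  held-loss s P t y = begin
    S * φ G + ∑[ e ∈ edges k ] enter P (at t) e * (S * φ (mass e y))
      ≤⟨ +-mono-≤ (*-monoʳ-≤ S departures) arrivals ⟩
    S * (φ (G ∸ D) + D * ⌊log₂ G ⌋) + S * φ I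
      ≡⟨ regroup S (φ (G ∸ D)) (φ I) (D * ⌊log₂ G ⌋) ⟩
    S * (φ (G ∸ D) + φ I) + S * (D * ⌊log₂ G ⌋)
      ≤⟨ +-mono-≤ (*-monoʳ-≤ S (φ-superadditive (G ∸ D) I)) charge ⟩
    S * φ (G ∸ D + I) + ∑[ e ∈ edges k ] leave P (at t) e * (S * φ (mass e y) + mass e y * (S * (s + 2)) + G)
      ≡⟨ cong (λ x → S * φ x + ∑[ e ∈ edges k ] leave P (at t) e * (S * φ (mass e y) + mass e y * (S * (s + 2)) + G)) (held-suc P t y) ⟨
    S * φ (held P (suc t) y) + ∑[ e ∈ edges k ] leave P (at t) e * (S * φ (mass e y) + mass e y * (S * (s + 2)) + G) ∎
    where
      open ≤-Reasoning
      S = 2 ^ s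
      G = held P t y
      D = outflow P (at t) y
      I = inflow P (at t) y
      regroup : ∀ s a b c → s * (a + c) + s * b ≡ s * (a + b) + s * c
      regroup = solve-∀
      departures : φ G ≤ φ (G ∸ D) + D * ⌊log₂ G ⌋
      departures = subst (λ x → φ x ≤ φ (G ∸ D) + D * ⌊log₂ x ⌋) (m∸n+n≡m (departing≤held P t y)) (φ-upper (G ∸ D) D)
      enter≤1 : ∀ e → enter P (at t) e ≤ 1
      enter≤1 e = *-mono-≤ (⟦⟧≤1 (owner (head e) Fin.≟ P)) (*-mono-≤ (⟦⟧≤1 (¬? (local? e))) (⟦⟧≤1 (departure e ≟ t)))
      swap : ∀ a b c → a * (b * c) ≡ b * (a * c)
      swap = solve-∀
      arrivals : ∑[ e ∈ edges k ] enter P (at t) e * (S * φ (mass e y)) ≤ S * φ I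
      arrivals = begin
        ∑[ e ∈ edges k ] enter P (at t) e * (S * φ (mass e y))     ≡⟨ (∑-cong λ e → trans (swap (enter P (at t) e) S _)
                                                                        (cong (S *_) (φ-scale (enter P (at t) e) _ (enter≤1 e)))) ⟩
        ∑[ e ∈ edges k ] S * φ (enter P (at t) e * mass e y)       ≡⟨ ∑-*ˡ S ⟩
        S * (∑[ e ∈ edges k ] φ (enter P (at t) e * mass e y))     ≤⟨ *-monoʳ-≤ S (φ-superadditive-∑ (edges k) _) ⟩
        S * φ I                                                    ∎
      charge : S * (D * ⌊log₂ G ⌋) ≤ ∑[ e ∈ edges k ] leave P (at t) e * (S * φ (mass e y) + mass e y * (S * (s + 2)) + G)
      charge = begin
        S * (D * ⌊log₂ G ⌋)                                                     ≡⟨ cong (S *_) (∑-*ʳ ⌊log₂ G ⌋) ⟨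
        S * (∑[ e ∈ edges k ] leave P (at t) e * mass e y * ⌊log₂ G ⌋)          ≡⟨ ∑-*ˡ S ⟨
        ∑[ e ∈ edges k ] S * (leave P (at t) e * mass e y * ⌊log₂ G ⌋)          ≡⟨ (∑-cong λ e → pull S (leave P (at t) e) (mass e y) ⌊log₂ G ⌋) ⟩
        ∑[ e ∈ edges k ] leave P (at t) e * (S * (mass e y * ⌊log₂ G ⌋))        ≤⟨ (∑-mono λ e → *-monoʳ-≤ (leave P (at t) e) (mass-loss s e y G)) ⟩
        ∑[ e ∈ edges k ] leave P (at t) e * (S * φ (mass e y) + mass e y * (S * (s + 2)) + G) ∎
        where
          pull : ∀ S c m g → S * (c * m * g) ≡ c * (S * (m * g))
          pull = solve-∀

  private
    ∑∑ : (Fin p → Fin n → ℕ) → ℕ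
    ∑∑ f = ∑p λ P → ∑[ y ∈ allFin n ] f P y

    ∑∑-+ : ∀ f g → ∑∑ (λ P y → f P y + g P y) ≡ ∑∑ f + ∑∑ g
    ∑∑-+ f g = trans (∑-cong λ P → ∑-+) ∑-+

    ∑∑-*ˡ : ∀ c f → ∑∑ (λ P y → c * f P y) ≡ c * ∑∑ f
    ∑∑-*ˡ c f = trans (∑-cong λ P → ∑-*ˡ c) (∑-*ˡ c)

    ∑∑-processors : ∀ (o : Edge k → Fin p) (c : Edge k → ℕ) (f : Edge k → Fin n → ℕ) →
      ∑∑ (λ P y → ∑[ e ∈ edges k ] ⟦ o e Fin.≟ P ⟧ * c e * f e y) ≡ ∑[ y ∈ allFin n ] ∑[ e ∈ edges k ] c e * f e y
    ∑∑-processors o c f = trans ∑-swap (∑-cong λ y → ∑-processors o c (λ e → f e y))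

  -- Sum `held-loss` over P and y. Every arc departing in t leaves one processor and enters one, so
  -- its `φ` terms, collected in X, cancel. What remains is s + 2 per unit of mass sent (Y) and the
  -- linear terms in `held` (Z).
  Φ-step : ∀ s → n ≤ 2 * (p * 2 ^ s) → ∀ (t : Fin T) → Φ (toℕ t) ≤ Φ (suc (toℕ t)) + h A t * (n * (p * (s + 6)))
  Φ-step s n≤ t = *-cancelˡ-≤ S {{m^n≢0 2 s}} (begin
      S * Φ τ                                               ≤⟨ +-cancelʳ-≤ X _ _ summed ⟩
      S * Φ (suc τ) + (Y + Z)                               ≤⟨ +-monoʳ-≤ (S * Φ (suc τ)) (+-mono-≤ Y≤ Z≤) ⟩
      -- In the resulting s + 6, the summand s + 2 stems from `mass-loss` and 4 from Z, where one
      -- factor n is replaced by 2 * p * 2 ^ s.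
      S * Φ (suc τ) + (h A t * (p * (n * K)) + 2 * h A t * (n * n))   ≤⟨ +-monoʳ-≤ (S * Φ (suc τ)) (+-monoʳ-≤ (h A t * (p * (n * K)))
                                                                (*-monoʳ-≤ (2 * h A t) (*-monoʳ-≤ n n≤))) ⟩
      S * Φ (suc τ) + (h A t * (p * (n * K)) + 2 * h A t * (n * (2 * (p * S))))   ≡⟨ regroup S (Φ (suc τ)) (h A t) p n s ⟩
      S * (Φ (suc τ) + h A t * (n * (p * (s + 6))))         ∎)
    where
      open ≤-Reasoning
      S = 2 ^ s
      K = S * (s + 2)
      τ = toℕ t
      X Y Z : ℕ
      X = ∑[ y ∈ allFin n ] ∑[ e ∈ edges k ] at τ e * (S * φ (mass e y))
      Y = ∑∑ λ P y → ∑[ e ∈ edges k ] leave P (at τ) e * (mass e y * K)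
      Z = ∑∑ λ P y → ∑[ e ∈ edges k ] leave P (at τ) e * held P τ y
      regroup : ∀ S f h p n s → S * f + (h * (p * (n * (S * (s + 2)))) + 2 * h * (n * (2 * (p * S)))) ≡ S * (f + h * (n * (p * (s + 6))))
      regroup = solve-∀
      summed : S * Φ τ + X ≤ S * Φ (suc τ) + (Y + Z) + X
      summed = begin
        S * Φ τ + X
          ≡⟨ cong₂ _+_ (∑∑-*ˡ S _) (∑∑-processors (owner ∘ head) (at τ) _) ⟨
        ∑∑ (λ P y → S * φ (held P τ y)) + ∑∑ (λ P y → ∑[ e ∈ edges k ] enter P (at τ) e * (S * φ (mass e y)))
          ≡⟨ ∑∑-+ _ _ ⟨
        ∑∑ (λ P y → S * φ (held P τ y) + ∑[ e ∈ edges k ] enter P (at τ) e * (S * φ (mass e y)))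
          ≤⟨ (∑-mono λ P → ∑-mono λ y → held-loss s P τ y) ⟩
        ∑∑ (λ P y → S * φ (held P (suc τ) y)
                    + ∑[ e ∈ edges k ] leave P (at τ) e * (S * φ (mass e y) + mass e y * K + held P τ y))
          ≡⟨ (∑-cong λ P → ∑-cong λ y → cong (S * φ (held P (suc τ) y) +_) (split P y)) ⟩
        ∑∑ (λ P y → S * φ (held P (suc τ) y)
                    + (∑[ e ∈ edges k ] leave P (at τ) e * (S * φ (mass e y))
                       + (∑[ e ∈ edges k ] leave P (at τ) e * (mass e y * K)
                          + ∑[ e ∈ edges k ] leave P (at τ) e * held P τ y)))
          ≡⟨ trans (∑∑-+ _ _) (cong₂ _+_ (∑∑-*ˡ S _) (trans (∑∑-+ _ _)
               (cong₂ _+_ (∑∑-processors (owner ∘ tail) (at τ) _) (∑∑-+ _ _)))) ⟩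
        S * Φ (suc τ) + (X + (Y + Z))
          ≡⟨ rotate (S * Φ (suc τ)) X (Y + Z) ⟩
        S * Φ (suc τ) + (Y + Z) + X ∎
        where
          rotate : ∀ a b c → a + (b + c) ≡ a + c + b
          rotate = solve-∀
          distrib : ∀ c u v w → c * (u + v + w) ≡ c * u + (c * v + c * w)
          distrib = solve-∀
          split : ∀ P y → ∑[ e ∈ edges k ] leave P (at τ) e * (S * φ (mass e y) + mass e y * K + held P τ y)
                        ≡ ∑[ e ∈ edges k ] leave P (at τ) e * (S * φ (mass e y))
                          + (∑[ e ∈ edges k ] leave P (at τ) e * (mass e y * K)
                             + ∑[ e ∈ edges k ] leave P (at τ) e * held P τ y)
          split P y = trans (∑-cong λ e → distrib (leave P (at τ) e) (S * φ (mass e y)) (mass e y * K) (held P τ y))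
            (trans ∑-+ (cong (∑[ e ∈ edges k ] leave P (at τ) e * (S * φ (mass e y)) +_) ∑-+))
      leaving≤ : ∀ P → ∑ (edges k) (leave P (at τ)) ≤ 2 * h A t
      leaving≤ P = ≤-trans (leave-count P t) (*-monoʳ-≤ 2 (sent≤h t P))
      Y≤ : Y ≤ h A t * (p * (n * K))
      Y≤ = *-cancelˡ-≤ 2 (begin
        2 * Y                                                                          ≡⟨ ∑-*ˡ 2 ⟨
        ∑p (λ P → 2 * (∑[ y ∈ allFin n ] ∑[ e ∈ edges k ] leave P (at τ) e * (mass e y * K)))   ≡⟨ ∑-cong each ⟩
        ∑p (λ P → ∑ (edges k) (leave P (at τ)) * n * K)                                ≤⟨ (∑-mono λ P → *-monoˡ-≤ K (*-monoˡ-≤ n (leaving≤ P))) ⟩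
        ∑p (λ P → 2 * h A t * n * K)                                                   ≡⟨ ∑-const p _ ⟩
        p * (2 * h A t * n * K)                                                        ≡⟨ reorder p (h A t) n K ⟩
        2 * (h A t * (p * (n * K)))                                                    ∎)
        where
          reorder : ∀ p h n K → p * (2 * h * n * K) ≡ 2 * (h * (p * (n * K)))
          reorder = solve-∀
          each : ∀ P → 2 * (∑[ y ∈ allFin n ] ∑[ e ∈ edges k ] leave P (at τ) e * (mass e y * K)) ≡ ∑ (edges k) (leave P (at τ)) * n * K
          each P = trans
            (cong (2 *_) (trans
              (∑-cong λ y → trans (∑-cong λ e → sym (*-assoc (leave P (at τ) e) (mass e y) K))
                                  (∑-*ʳ K {λ e → leave P (at τ) e * mass e y}))
              (∑-*ʳ K {outflow P (at τ)})))
            (trans (sym (*-assoc 2 (∑ (allFin n) (outflow P (at τ))) K)) (cong (_* K) (∑-mass (leave P (at τ)))))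
      -- The averaging over processors: the number of leaving arcs has a bound common to all P, so
      -- only the total mass n * n matters.
      Z≤ : Z ≤ 2 * h A t * (n * n)
      Z≤ = begin
        Z                                                                        ≡⟨ (∑-cong λ P → trans (∑-cong λ y → ∑-*ʳ (held P τ y) {leave P (at τ)})
                                                                                              (∑-*ˡ (∑ (edges k) (leave P (at τ))) {held P τ})) ⟩
        ∑p (λ P → ∑ (edges k) (leave P (at τ)) * ∑ (allFin n) (held P τ))        ≤⟨ (∑-mono λ P → *-monoˡ-≤ _ (leaving≤ P)) ⟩
        ∑p (λ P → 2 * h A t * ∑ (allFin n) (held P τ))                           ≡⟨ ∑-*ˡ (2 * h A t) ⟩
        2 * h A t * ∑p (λ P → ∑ (allFin n) (held P τ))                           ≡⟨ cong (2 * h A t *_) (trans ∑-swap (trans (∑-cong (held-total τ)) (∑-const n n))) ⟩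
        2 * h A t * (n * n)                                                      ∎

  Φ-total : ∀ s → n ≤ 2 * (p * 2 ^ s) → Φ 0 ≤ Φ T + H A * (n * (p * (s + 6)))
  Φ-total s n≤ = begin
    Φ 0                                                              ≤⟨ descend (Φ ∘ toℕ) (λ t → h A t * (n * (p * (s + 6)))) step′ (fromℕ T) ⟩
    Φ (toℕ (fromℕ T)) + ∑[ t ∈ allFin T ] h A t * (n * (p * (s + 6)))   ≡⟨ cong₂ _+_ (cong Φ (toℕ-fromℕ T)) (trans (∑-*ʳ _) (cong (_* _) (sym H-∑))) ⟩
    Φ T + H A * (n * (p * (s + 6)))                                  ∎
    where
      open ≤-Reasoning
      step′ : ∀ t → Φ (toℕ (inject₁ t)) ≤ Φ (toℕ (Fin.suc t)) + h A t * (n * (p * (s + 6)))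
      step′ t rewrite toℕ-inject₁ t = Φ-step s n≤ t

  -- Inputs are not replicated: the whole mass of y lies with `place y`, and all other terms are
  -- `φ 0`.
  Φ-0 : Φ 0 ≡ n * φ n
  Φ-0 = begin
    Φ 0                                                                     ≡⟨ ∑-swap ⟩
    ∑[ y ∈ allFin n ] ∑p (λ P → φ (held P 0 y))                             ≡⟨ (∑-cong λ y → trans (∑-cong λ P →
        trans (cong φ (held-0 P y)) (sym (φ-scale ⟦ place y Fin.≟ P ⟧ n (⟦⟧≤1 (place y Fin.≟ P))))) (∑-δ (place y) (λ _ → φ n))) ⟩
    ∑[ y ∈ allFin n ] φ n                                                   ≡⟨ ∑-const n (φ n) ⟩
    n * φ n                                                                 ∎
    where open ≡-Reasoning

  Φ-T : ∀ N → (∀ P → outputs P ≤ N) → Φ T ≤ n * (n * ⌊log₂ N ⌋)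
  Φ-T N out≤ = begin
    Φ T                                           ≡⟨ (∑-cong λ P → trans (∑-cong λ y → cong φ (held-T P y)) (∑-const n _)) ⟩
    ∑p (λ P → n * φ (outputs P))                  ≤⟨ (∑-mono λ P → *-monoʳ-≤ n (≤-trans (φ-upper 0 (outputs P)) (*-monoʳ-≤ (outputs P) (⌊log₂⌋-mono-≤ (out≤ P))))) ⟩
    ∑p (λ P → n * (outputs P * ⌊log₂ N ⌋))        ≡⟨ trans (∑-*ˡ n) (cong (n *_) (∑-*ʳ ⌊log₂ N ⌋)) ⟩
    n * (∑p outputs * ⌊log₂ N ⌋)                  ≡⟨ cong (λ x → n * (x * ⌊log₂ N ⌋)) outputs-total ⟩
    n * (n * ⌊log₂ N ⌋)                           ∎
    where open ≤-Reasoning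

  potential-bound : ∀ s N → n ≤ 2 * (p * 2 ^ s) → (∀ P → outputs P ≤ N) →
                    n * k ≤ n * (⌊log₂ N ⌋ + 2) + H A * (p * (s + 6))
  potential-bound s N n≤ out≤ = begin
    n * k                                                       ≤⟨ φ-2^ k ⟩
    φ n + 2 * n                                                 ≤⟨ +-monoˡ-≤ (2 * n) (*-cancelˡ-≤ n {{m^n≢0 2 k}} (begin
        n * φ n                                                 ≡⟨ Φ-0 ⟨
        Φ 0                                                     ≤⟨ Φ-total s n≤ ⟩
        Φ T + H A * (n * (p * (s + 6)))                         ≤⟨ +-monoˡ-≤ _ (Φ-T N out≤) ⟩
        n * (n * ⌊log₂ N ⌋) + H A * (n * (p * (s + 6)))         ≡⟨ factor n ⌊log₂ N ⌋ (H A) (p * (s + 6)) ⟩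
        n * (n * ⌊log₂ N ⌋ + H A * (p * (s + 6)))               ∎)) ⟩
    n * ⌊log₂ N ⌋ + H A * (p * (s + 6)) + 2 * n                 ≡⟨ collect n ⌊log₂ N ⌋ (H A * (p * (s + 6))) ⟩
    n * (⌊log₂ N ⌋ + 2) + H A * (p * (s + 6))                   ∎
    where
      open ≤-Reasoning
      factor : ∀ n l h q → n * (n * l) + h * (n * q) ≡ n * (n * l + h * q)
      factor = solve-∀
      collect : ∀ n l x → n * l + x + 2 * n ≡ n * (l + 2) + x
      collect = solve-∀

-- Combining the two bounds

-- The constant ε is a / (a + Δ). The hypothesis `small` singles out the case where H is too small
-- to be linear in n with a certain constant; the other case is treated directly in `combine`.
module Balanced {k p : ℕ} (A : BSPAlg k p) (valid : Valid A) (a Δ : ℕ) (0<Δ : 0 < Δ) (0<k : 0 < k)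
  (work : ∀ P → (a + Δ) * computedBy A P ≤ a * (2 ^ k * k)) (small : 4 * (a + Δ) * H A ≤ Δ * 2 ^ k) where
  open Analysis A valid

  private
    b = a + Δ

  inputs≤ : ∀ P → b * inputs P ≤ a * n + 2 * b * H A
  inputs≤ P = *-cancelˡ-≤ k {{>-nonZero 0<k}} (begin
    k * (b * inputs P)                                ≡⟨ regroup k b (inputs P) ⟩
    b * (k * inputs P)                                ≤⟨ *-monoʳ-≤ b (inputs-bounded P) ⟩
    b * (computedBy A P + k * (2 * H A))              ≡⟨ *-distribˡ-+ b (computedBy A P) _ ⟩
    b * computedBy A P + b * (k * (2 * H A))          ≤⟨ +-monoˡ-≤ _ (work P) ⟩
    a * (n * k) + b * (k * (2 * H A))                 ≡⟨ regroup' a n k b (H A) ⟩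
    k * (a * n + 2 * b * H A)                         ∎)
    where
      open ≤-Reasoning
      regroup : ∀ k b x → k * (b * x) ≡ b * (k * x)
      regroup = solve-∀
      regroup' : ∀ a n k b h → a * (n * k) + b * (k * (2 * h)) ≡ k * (a * n + 2 * b * h)
      regroup' = solve-∀

  -- By `inputs≤` and `small`, at least n Δ / (2 b) inputs start outside P. Each output needs a unit
  -- of each of them, while at most H n enters P. This yields Δ * o ≤ 2 b H, and Δ is at least 1.
  outputs≤ : ∀ P → outputs P ≤ 2 * b * H A
  outputs≤ P = *-cancelˡ-≤ n {{m^n≢0 2 k}} (+-cancelˡ-≤ ((2 * a * n + Δ * n) * o) _ _ (begin
    (2 * a * n + Δ * n) * o + n * o                          ≤⟨ +-monoʳ-≤ ((2 * a * n + Δ * n) * o) (m≤n*m (n * o) Δ {{>-nonZero 0<Δ}}) ⟩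
    (2 * a * n + Δ * n) * o + Δ * (n * o)                    ≡⟨ regroup a Δ n o ⟩
    2 * b * (n * o)                                          ≤⟨ *-monoʳ-≤ (2 * b) (outputs-bounded P) ⟩
    2 * b * (inputs P * o + H A * n)                         ≡⟨ regroup' b (inputs P) o (H A) n ⟩
    2 * (b * inputs P) * o + n * (2 * b * H A)               ≤⟨ +-monoˡ-≤ _ (*-monoˡ-≤ o (*-monoʳ-≤ 2 (inputs≤ P))) ⟩
    2 * (a * n + 2 * b * H A) * o + n * (2 * b * H A)        ≡⟨ cong (λ x → x * o + n * (2 * b * H A)) (regroup'' a n b (H A)) ⟩
    (2 * a * n + 4 * b * H A) * o + n * (2 * b * H A)        ≤⟨ +-monoˡ-≤ _ (*-monoˡ-≤ o (+-monoʳ-≤ (2 * a * n) small)) ⟩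
    (2 * a * n + Δ * n) * o + n * (2 * b * H A)              ∎))
    where
      open ≤-Reasoning
      o = outputs P
      regroup : ∀ a d n o → (2 * a * n + d * n) * o + d * (n * o) ≡ 2 * (a + d) * (n * o)
      regroup = solve-∀
      regroup' : ∀ b x o h n → 2 * b * (x * o + h * n) ≡ 2 * (b * x) * o + n * (2 * b * h)
      regroup' = solve-∀
      regroup'' : ∀ a n b h → 2 * (a * n + 2 * b * h) ≡ 2 * a * n + 4 * b * h
      regroup'' = solve-∀

  n≤ : n ≤ p * (2 * b * H A)
  n≤ = begin
    n                                    ≡⟨ outputs-total ⟨
    ∑ (allFin p) outputs                 ≤⟨ ∑-mono outputs≤ ⟩
    ∑ (allFin p) (λ _ → 2 * b * H A)     ≡⟨ ∑-const p _ ⟩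
    p * (2 * b * H A)                    ∎
    where open ≤-Reasoning

-- Elementary estimates and the final case distinction

n≤2*p*2^lg : ∀ n p → 0 < p → n ≤ 2 * (p * 2 ^ lg (divℕ n p))
n≤2*p*2^lg n p@(suc _) _ = begin
  n                                        ≡⟨ m≡m%n+[m/n]*n n p ⟩
  n % p + n / p * p                        ≤⟨ +-monoˡ-≤ (n / p * p) (<⇒≤ (m%n<n n p)) ⟩
  -- Both roundings together cost only a factor 2, as ⌊n / p⌋ + 1 is still at most 2 ^ (1 + ⌊log₂ ⌊n
  -- / p⌋⌋).
  suc (n / p) * p                          ≤⟨ *-monoˡ-≤ p (n<2^[1+⌊log₂n⌋] (n / p)) ⟩
  2 ^ suc ⌊log₂ n / p ⌋ * p                ≤⟨ *-monoˡ-≤ p (*-monoʳ-≤ 2 (^-monoʳ-≤ 2 (m≤n⊔m 1 ⌊log₂ n / p ⌋))) ⟩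
  2 * 2 ^ lg (n / p) * p                   ≡⟨ regroup (2 ^ lg (n / p)) p ⟩
  2 * (p * 2 ^ lg (n / p))                 ∎
  where
    open ≤-Reasoning
    regroup : ∀ x p → 2 * x * p ≡ 2 * (p * x)
    regroup = solve-∀

2^-cancel-≤ : ∀ {i j} → 2 ^ i ≤ 2 ^ j → i ≤ j
2^-cancel-≤ {i} {j} le = begin
  i                ≡⟨ ⌊log₂[2^n]⌋≡n i ⟨
  ⌊log₂ 2 ^ i ⌋    ≤⟨ ⌊log₂⌋-mono-≤ le ⟩
  ⌊log₂ 2 ^ j ⌋    ≡⟨ ⌊log₂[2^n]⌋≡n j ⟩
  j                ∎
  where open ≤-Reasoning

-- A crude bound, k ≤ 1 + p + s, which is enough when H is already of order n.
k≤3*p*s : ∀ k p s → 0 < p → 0 < s → 2 ^ k ≤ 2 * (p * 2 ^ s) → k ≤ 3 * (p * s)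
k≤3*p*s k p@(suc p-1) s@(suc s-1) _ _ le = begin
  k                    ≤⟨ 2^-cancel-≤ (begin
      2 ^ k                    ≤⟨ le ⟩
      2 * (p * 2 ^ s)          ≤⟨ *-monoʳ-≤ 2 (*-monoˡ-≤ (2 ^ s) (n≤2^n p)) ⟩
      2 * (2 ^ p * 2 ^ s)      ≡⟨ cong (2 *_) (^-distribˡ-+-* 2 p s) ⟨
      2 ^ suc (p + s)          ∎) ⟩
  suc (p + s)          ≤⟨ m≤m+n _ (2 * (p-1 + s-1) + 3 * (p-1 * s-1)) ⟩
  suc (p + s) + (2 * (p-1 + s-1) + 3 * (p-1 * s-1)) ≡⟨ expand p-1 s-1 ⟩
  3 * (p * s)          ∎
  where
    open ≤-Reasoning
    expand : ∀ x y → suc (suc x + suc y) + (2 * (x + y) + 3 * (x * y)) ≡ 3 * (suc x * suc y)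
    expand = solve-∀

k≤2⌊k/2⌋+1 : ∀ k → k ≤ 2 * ⌊ k /2⌋ + 1
k≤2⌊k/2⌋+1 k = begin
  k                              ≡⟨ ⌊n/2⌋+⌈n/2⌉≡n k ⟨
  ⌊ k /2⌋ + ⌈ k /2⌉              ≤⟨ +-monoʳ-≤ ⌊ k /2⌋ (⌊n/2⌋-mono (n≤1+n (suc k))) ⟩
  ⌊ k /2⌋ + suc ⌊ k /2⌋          ≡⟨ regroup ⌊ k /2⌋ ⟩
  2 * ⌊ k /2⌋ + 1                ∎
  where
    open ≤-Reasoning
    regroup : ∀ m → m + suc m ≡ 2 * m + 1
    regroup = solve-∀

2*⌊k/2⌋≤k : ∀ k → 2 * ⌊ k /2⌋ ≤ k
2*⌊k/2⌋≤k k = begin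
  2 * ⌊ k /2⌋                ≡⟨ cong (⌊ k /2⌋ +_) (+-identityʳ ⌊ k /2⌋) ⟩
  ⌊ k /2⌋ + ⌊ k /2⌋          ≤⟨ +-monoʳ-≤ ⌊ k /2⌋ (⌊n/2⌋≤⌈n/2⌉ k) ⟩
  ⌊ k /2⌋ + ⌈ k /2⌉          ≡⟨ ⌊n/2⌋+⌈n/2⌉≡n k ⟩
  k                          ∎
  where open ≤-Reasoning

-- Of 4 n k, the final potential accounts for at most 2 n k and the additive constants for 8 n ≤ n
-- k. Communication pays for the remaining n k; 28 is 4 * 7, from s + 6 ≤ 7 s.
few-outputs : ∀ n k L h p s → 8 ≤ k → 0 < s → 2 * L ≤ k →
              n * k ≤ n * (L + 2) + h * (p * (s + 6)) → n * k ≤ 28 * (h * (p * s))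
few-outputs n k L h p s 8≤k 0<s 2L≤k le = +-cancelˡ-≤ (3 * (n * k)) _ _ (begin
  3 * (n * k) + n * k                              ≡⟨ regroup (n * k) ⟩
  4 * (n * k)                                      ≤⟨ *-monoʳ-≤ 4 le ⟩
  4 * (n * (L + 2) + h * (p * (s + 6)))            ≡⟨ regroup' n L h p s ⟩
  n * (2 * (2 * L) + 8) + 4 * (h * (p * (s + 6)))  ≤⟨ +-mono-≤ (*-monoʳ-≤ n (+-mono-≤ (*-monoʳ-≤ 2 2L≤k) 8≤k))
                                                       (*-monoʳ-≤ 4 (*-monoʳ-≤ h (*-monoʳ-≤ p (+-monoʳ-≤ s (*-monoʳ-≤ 6 0<s))))) ⟩
  n * (2 * k + k) + 4 * (h * (p * (s + 6 * s)))    ≡⟨ regroup'' n k h p s ⟩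
  3 * (n * k) + 28 * (h * (p * s))                 ∎)
  where
    open ≤-Reasoning
    regroup : ∀ x → 3 * x + x ≡ 4 * x
    regroup = solve-∀
    regroup' : ∀ n L h p s → 4 * (n * (L + 2) + h * (p * (s + 6))) ≡ n * (2 * (2 * L) + 8) + 4 * (h * (p * (s + 6)))
    regroup' = solve-∀
    regroup'' : ∀ n k h p s → n * (2 * k + k) + 4 * (h * (p * (s + 6 * s))) ≡ 3 * (n * k) + 28 * (h * (p * s))
    regroup'' = solve-∀

-- X will be a multiple of H, so H is at least of order √n here, while n log n / p is smaller.
many-processors : ∀ k s p X → 0 < s → 8 * s < k → 2 ^ k ≤ 2 * (p * 2 ^ s) → 2 ^ ⌊ k /2⌋ ≤ X →
                  2 ^ k * k ≤ 10 * (p * X)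
many-processors k s p X 0<s 8s<k n≤ X≥ = begin
  2 ^ k * k                                ≤⟨ *-mono-≤ n≤ k≤5*2^r ⟩
  2 * (p * 2 ^ s) * (5 * 2 ^ r)            ≡⟨ regroup p (2 ^ s) (2 ^ r) ⟩
  10 * (p * (2 ^ s * 2 ^ r))               ≡⟨ cong (λ x → 10 * (p * x)) (trans (sym (^-distribˡ-+-* 2 s r)) (cong (2 ^_) s+r≡m)) ⟩
  10 * (p * 2 ^ m)                         ≤⟨ *-monoʳ-≤ 10 (*-monoʳ-≤ p X≥) ⟩
  10 * (p * X)                             ∎
  where
    open ≤-Reasoning
    m = ⌊ k /2⌋
    -- What is left of the exponent of √n once 2 ^ s is split off. It is at least s, so k is linear
    -- in r and hence at most 5 * 2 ^ r.
    r = m ∸ s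
    4s≤m : 4 * s ≤ m
    4s≤m = *-cancelˡ-≤ 2 (+-cancelʳ-≤ 1 _ _ (begin
      2 * (4 * s) + 1      ≡⟨ double s ⟩
      suc (8 * s)          ≤⟨ 8s<k ⟩
      k                    ≤⟨ k≤2⌊k/2⌋+1 k ⟩
      2 * m + 1            ∎))
      where
        double : ∀ s → 2 * (4 * s) + 1 ≡ suc (8 * s)
        double = solve-∀
    s+r≡m : s + r ≡ m
    s+r≡m = m+[n∸m]≡n (≤-trans (m≤n*m s 4) 4s≤m)
    s≤r : s ≤ r
    s≤r = +-cancelˡ-≤ s _ _ (begin
      s + s        ≡⟨ cong (s +_) (+-identityʳ s) ⟨
      2 * s        ≤⟨ *-monoˡ-≤ s (m≤m+n 2 2) ⟩
      4 * s        ≤⟨ 4s≤m ⟩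
      m            ≡⟨ s+r≡m ⟨
      s + r        ∎)
    k≤5*2^r : k ≤ 5 * 2 ^ r
    k≤5*2^r = begin
      k                         ≤⟨ k≤2⌊k/2⌋+1 k ⟩
      2 * m + 1                 ≡⟨ cong (λ x → 2 * x + 1) s+r≡m ⟨
      2 * (s + r) + 1           ≤⟨ +-mono-≤ (*-monoʳ-≤ 2 (+-monoˡ-≤ r s≤r)) (m^n>0 2 r) ⟩
      2 * (r + r) + 2 ^ r       ≤⟨ +-monoˡ-≤ (2 ^ r) (*-monoʳ-≤ 2 (+-mono-≤ (n≤2^n r) (n≤2^n r))) ⟩
      2 * (2 ^ r + 2 ^ r) + 2 ^ r   ≡⟨ five (2 ^ r) ⟩
      5 * 2 ^ r                 ∎
      where
        five : ∀ x → 2 * (x + x) + x ≡ 5 * x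
        five = solve-∀
    regroup : ∀ p x y → 2 * (p * x) * (5 * y) ≡ 10 * (p * (x * y))
    regroup = solve-∀

lg-2^ : ∀ k → 0 < k → lg (2 ^ k) ≡ k
lg-2^ (suc k) _ = cong (1 ⊔_) (⌊log₂[2^n]⌋≡n (suc k))

-- If H is of order n, `k≤3*p*s` suffices. Otherwise N = 2 b H bounds the outputs per processor. If
-- N is at most 2 ^ ⌊ k /2⌋, `few-outputs` applies; if not, n ≤ p N settles the case k ≤ 8 s and
-- `many-processors` the case 8 s < k. The largest constant, 28, covers all cases.
combine : ∀ n k p s b Δ h → n ≡ 2 ^ k → 8 ≤ k → 0 < p → 0 < s → 0 < b → 0 < Δ → n ≤ 2 * (p * 2 ^ s) →
          (4 * b * h ≤ Δ * n → n ≤ p * (2 * b * h) × n * k ≤ n * (⌊log₂ 2 * b * h ⌋ + 2) + h * (p * (s + 6))) →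
          n * k ≤ 28 * b * (h * (p * s))
combine n k p s b Δ h refl 8≤k 0<p 0<s 0<b 0<Δ n≤2ps bounds = cases (4 * b * h ≤? Δ * n)
  where
    open ≤-Reasoning
    weaken : ∀ c → c ≤ 28 → ∀ {x} → n * k ≤ x → x ≡ c * b * (h * (p * s)) → n * k ≤ 28 * b * (h * (p * s))
    weaken c c≤28 le eq = ≤-trans le (≤-trans (≤-reflexive eq) (*-monoˡ-≤ (h * (p * s)) (*-monoˡ-≤ b c≤28)))
    high-communication : ∀ b h x → 4 * b * h * (3 * x) ≡ 12 * b * (h * x)
    high-communication = solve-∀
    few-processors : ∀ p b h s → p * (2 * b * h) * (8 * s) ≡ 16 * b * (h * (p * s))
    few-processors = solve-∀
    rest : ∀ p b h s → 10 * (p * (2 * b * h)) * s ≡ 20 * b * (h * (p * s))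
    rest = solve-∀
    many-outputs : 4 * b * h ≤ Δ * n → 2 ^ ⌊ k /2⌋ ≤ 2 * b * h → Dec (k ≤ 8 * s) → n * k ≤ 28 * b * (h * (p * s))
    many-outputs small many (yes k≤8s) =
      weaken 16 (m≤m+n 16 12) (*-mono-≤ (proj₁ (bounds small)) k≤8s) (few-processors p b h s)
    many-outputs small many (no k>8s) = weaken 20 (m≤m+n 20 8) (begin
        n * k                            ≤⟨ many-processors k s p (2 * b * h) 0<s (≰⇒> k>8s) n≤2ps many ⟩
        10 * (p * (2 * b * h))           ≡⟨ *-identityʳ _ ⟨
        10 * (p * (2 * b * h)) * 1       ≤⟨ *-monoʳ-≤ (10 * (p * (2 * b * h))) 0<s ⟩
        10 * (p * (2 * b * h)) * s       ∎) (rest p b h s)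
    low-communication : 4 * b * h ≤ Δ * n → Dec (2 * b * h ≤ 2 ^ ⌊ k /2⌋) → n * k ≤ 28 * b * (h * (p * s))
    low-communication small (no many) = many-outputs small (≰⇒≥ many) (k ≤? 8 * s)
    low-communication small (yes few) = begin
        n * k                      ≤⟨ few-outputs n k ⌊log₂ 2 * b * h ⌋ h p s 8≤k 0<s
                                        (≤-trans (*-monoʳ-≤ 2 (≤-trans (⌊log₂⌋-mono-≤ few) (≤-reflexive (⌊log₂[2^n]⌋≡n ⌊ k /2⌋)))) (2*⌊k/2⌋≤k k))
                                        (proj₂ (bounds small)) ⟩
        28 * (h * (p * s))         ≤⟨ *-monoˡ-≤ (h * (p * s)) (*-monoʳ-≤ 28 0<b) ⟩
        28 * b * (h * (p * s))     ∎
    cases : Dec (4 * b * h ≤ Δ * n) → n * k ≤ 28 * b * (h * (p * s))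
    cases (yes small) = low-communication small (2 * b * h ≤? 2 ^ ⌊ k /2⌋)
    cases (no big) = weaken 12 (m≤m+n 12 16)
      (*-mono-≤ (≤-trans (m≤n*m n Δ {{>-nonZero 0<Δ}}) (≰⇒≥ big)) (k≤3*p*s k p s 0<p 0<s n≤2ps))
      (high-communication b h (p * s))

communication-bound : ∀ a Δ → 0 < Δ → ∀ {k p} → 8 ≤ k → 0 < p → (A : BSPAlg k p) → Valid A →
  (∀ P → (a + Δ) * computedBy A P ≤ a * (2 ^ k * k)) →
  2 ^ k * k ≤ 28 * (a + Δ) * (H A * (p * lg (divℕ (2 ^ k) p)))
communication-bound a Δ 0<Δ {k} {p} 8≤k 0<p A valid work =
  combine (2 ^ k) k p s (a + Δ) Δ (H A) refl 8≤k 0<p (m≤m⊔n 1 ⌊log₂ divℕ (2 ^ k) p ⌋) (≤-trans 0<Δ (m≤n+m Δ a)) 0<Δ n≤2ps λ small →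
    Balanced.n≤ A valid a Δ 0<Δ 0<k work small ,
    Analysis.potential-bound A valid s (2 * (a + Δ) * H A) n≤2ps (Balanced.outputs≤ A valid a Δ 0<Δ 0<k work small)
  where
    s = lg (divℕ (2 ^ k) p)
    0<k : 0 < k
    0<k = ≤-trans (s≤s z≤n) 8≤k
    n≤2ps : 2 ^ k ≤ 2 * (p * 2 ^ s)
    n≤2ps = n≤2*p*2^lg (2 ^ k) p 0<p

theorem4 : (a b : ℕ) → 0 < a → a < b →
    Σ ℕ λ c → Σ ℕ λ d → Σ ℕ λ n₀ → 0 < c × 0 < d ×
    ((k p : ℕ) → n₀ ≤ 2 ^ k → 1 < p → p ≤ 2 ^ k →
    (A : BSPAlg k p) → Valid A →
    ((P : Fin p) → b * computedBy A P ≤ a * (2 ^ k * lg (2 ^ k))) →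
    c * (2 ^ k * lg (2 ^ k)) ≤ d * (H A * (p * lg (divℕ (2 ^ k) p))))
-- With Δ = b ∸ a the constant depends on ε = a / b only through b. The threshold 2 ^ 8 ensures 8 ≤
-- k, as `few-outputs` requires.
theorem4 a b 0<a a<b = 1 , 28 * b , 2 ^ 8 , s≤s z≤n , *-mono-≤ {1} {28} (s≤s z≤n) (≤-trans (s≤s z≤n) a<b) , bound
  where
    a+Δ≡b : a + (b ∸ a) ≡ b
    a+Δ≡b = m+[n∸m]≡n (<⇒≤ a<b)
    bound : (k p : ℕ) → 2 ^ 8 ≤ 2 ^ k → 1 < p → p ≤ 2 ^ k → (A : BSPAlg k p) → Valid A →
            ((P : Fin p) → b * computedBy A P ≤ a * (2 ^ k * lg (2 ^ k))) →
            1 * (2 ^ k * lg (2 ^ k)) ≤ 28 * b * (H A * (p * lg (divℕ (2 ^ k) p)))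
    bound k p 2^8≤n 1<p _ A valid work = ≤-trans
      (≤-reflexive (trans (*-identityˡ _) (cong (2 ^ k *_) lg-n)))
      (subst (λ x → 2 ^ k * k ≤ 28 * x * (H A * (p * lg (divℕ (2 ^ k) p)))) a+Δ≡b
        (communication-bound a (b ∸ a) (m<n⇒0<n∸m a<b) 8≤k (<⇒≤ 1<p) A valid
          (λ P → subst₂ (λ x y → x * computedBy A P ≤ a * (2 ^ k * y)) (sym a+Δ≡b) lg-n (work P))))
      where
        8≤k : 8 ≤ k
        8≤k = 2^-cancel-≤ 2^8≤n
        lg-n : lg (2 ^ k) ≡ k
        lg-n = lg-2^ k (≤-trans (s≤s z≤n) 8≤k)
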